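{- Let $q$ be an indeterminate. For $n\ge 0$ put $[n]=[n]_q=1+q+\dots+q^{n-1}$ and $[n]!=[1][2]\cdots[n]$. Consider the formal power series in $x$ over the field $\mathbb{Q}(q)$ $$\exp_q(x)=\sum_{n\ge 0}\frac{x^n}{[n]!},\qquad \operatorname{Exp}_q(x)=\sum_{n\ge 0}q^{\binom n2}\frac{x^n}{[n]!}.$$ Let $e_n(q)$ and $E_n(q)$ ($n\ge1$) be the unique elements of $\mathbb{Q}(q)$ such that $$\exp_q(x)=\prod_{n\ge 1}\bigl(1+e_n(q)x^n\bigr),\qquad \operatorname{Exp}_q(x)=\prod_{n\ge 1}\bigl(1+E_n(q)x^n\bigr).$$ Then $$e_n(q)=\sum_{d\mid n,\ d>1}(-1)^d\frac{e_{n/d}(q)^d}{d}+\frac{(1-q)^{n-1}}{n[n]},\qquad E_n(q)=\sum_{d\mid n,\ d>1}(-1)^d\frac{E_{n/d}(q)^d}{d}+\frac{(q-1)^{n-1}}{n[n]}$$ for all $n\ge1$, we have $\operatorname{Exp}_q(x)=\exp_{q^{ -1}}(x)=1/\exp_q(-x)$, and for all $n\ge 0$ $$e_{2n+1}(q)=E_{2n+1}(q)=e_{2n+1}(1/q).$$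
   Context: A power product expansion of a formal power series $f(x)=\sum_{n\ge0}a_nx^n$ with $a_0=1$ is a representation $f(x)=\prod_{n\ge1}(1+g_nx^n)$; the coefficients $g_n$ exist and are uniquely determined (the first $n$ factors of the product must agree with $f$ up to order $x^n$). An empty divisor sum is $0$. -}

module Defs where

open import Data.Nat as ℕ using (ℕ; zero; suc; _∸_; _≤_; NonZero)
open import Data.Nat.Divisibility using (_∣?_)
open import Data.Nat.Combinatorics using (_C_)
open import Data.Integer as ℤ using (ℤ; +_)
open import Data.List using (List; []; _∷_; map; foldr; reverse; replicate; length; _++_; upTo)
open import Data.Product using (_×_)
open import Data.Bool using (Bool; true; false; if_then_else_)
open import Relation.Nullary using (¬_; does)
open import Relation.Binary.PropositionalEquality using (_≡_)

-- Polynomials ℤ[q] as coefficient lists (constant term first)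

Poly : Set
Poly = List ℤ

coeff : Poly → ℕ → ℤ
coeff []       _       = + 0
coeff (a ∷ p)  zero    = a
coeff (a ∷ p)  (suc i) = coeff p i

-- equality of polynomials: equal coefficient sequences (trailing zeros ignored)
_≈ₚ_ : Poly → Poly → Set
p ≈ₚ r = ∀ i → coeff p i ≡ coeff r i

0ₚ : Poly
0ₚ = []

_+ₚ_ : Poly → Poly → Poly
[]      +ₚ r       = r
(a ∷ p) +ₚ []      = a ∷ p
(a ∷ p) +ₚ (b ∷ r) = (a ℤ.+ b) ∷ (p +ₚ r)

_*ₚ_ : Poly → Poly → Poly
[]      *ₚ r = []
(a ∷ p) *ₚ r = map (a ℤ.*_) r +ₚ ((+ 0) ∷ (p *ₚ r))

negₚ : Poly → Poly
negₚ = map (λ a → ℤ.- a)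

-- The field ℚ(q) = Frac(ℤ[q]): fractions num/den, with den ≠ 0
-- (validity is a predicate), equality by cross-multiplication.

record K : Set where
  constructor _//_
  field
    num : Poly
    den : Poly
open K public

Valid : K → Set
Valid f = ¬ (den f ≈ₚ 0ₚ)

infix 4 _≈_
_≈_ : K → K → Set
f ≈ g = (num f *ₚ den g) ≈ₚ (num g *ₚ den f)

fromℤ : ℤ → K
fromℤ a = (a ∷ []) // (+ 1 ∷ [])

fromℕ : ℕ → K
fromℕ n = fromℤ (+ n)

0K 1K : K
0K = fromℕ 0
1K = fromℕ 1

infixl 6 _+K_ _-K_
infixl 7 _*K_ _÷_

_+K_ : K → K → K
(a // b) +K (c // d) = ((a *ₚ d) +ₚ (c *ₚ b)) // (b *ₚ d)

_*K_ : K → K → K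
(a // b) *K (c // d) = (a *ₚ c) // (b *ₚ d)

-K_ : K → K
-K (a // b) = negₚ a // b

_-K_ : K → K → K
f -K g = f +K (-K g)

-- division (only meaningful for a valid nonzero divisor)
_÷_ : K → K → K
(a // b) ÷ (c // d) = (a *ₚ d) // (b *ₚ c)

_^K_ : K → ℕ → K
f ^K zero  = 1K
f ^K suc n = f *K (f ^K n)

q : K
q = (+ 0 ∷ + 1 ∷ []) // (+ 1 ∷ [])

-- substitution q ↦ 1/q :  a(1/q)/b(1/q) = (q^{L-1} a(1/q)) / (q^{L-1} b(1/q))
pad : ℕ → Poly → Poly
pad L p = p ++ replicate (L ∸ length p) (+ 0)

σ : K → K
σ (a // b) = reverse (pad L a) // reverse (pad L b)
  where L = length a ℕ.⊔ length b

sumK : List K → K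
sumK = foldr _+K_ 0K

qint : K → ℕ → K
qint t n = sumK (map (t ^K_) (upTo n))

qfact : K → ℕ → K
qfact t zero    = 1K
qfact t (suc n) = qfact t n *K qint t (suc n)

PS : Set
PS = ℕ → K

_≈PS_ : PS → PS → Set
f ≈PS g = ∀ n → f n ≈ g n

_⋆_ : PS → PS → PS
(f ⋆ g) n = sumK (map (λ k → f k *K g (n ∸ k)) (upTo (suc n)))

onePS : PS
onePS zero    = 1K
onePS (suc n) = 0K

expq : K → PS
expq t n = 1K ÷ qfact t n

Expq : K → PS
Expq t n = (t ^K (n C 2)) ÷ qfact t n

negx : PS → PS
negx f n = ((-K 1K) ^K n) *K f n

-- partialProd g N = coefficients of ∏_{n=1}^{N} (1 + g n x^n)
partialProd : (ℕ → K) → ℕ → PS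
partialProd g zero    = onePS
partialProd g (suc N) m with does (suc N ℕ.≤? m)
... | true  = partialProd g N m +K (g (suc N) *K partialProd g N (m ∸ suc N))
... | false = partialProd g N m

-- f = ∏_{n≥1} (1 + g_n x^n): the g_n (n ≥ 1) are valid elements of ℚ(q) and
-- the first N factors agree with f up to order x^N, for every N.
IsPowerProduct : PS → (ℕ → K) → Set
IsPowerProduct f g =
  (∀ n → 1 ≤ n → Valid (g n)) × (∀ N m → m ≤ N → partialProd g N m ≈ f m)

divTerm : (ℕ → K) → ℕ → ℕ → K
divTerm g n zero          = 0K
divTerm g n (suc zero)    = 0K
divTerm g n d@(suc (suc k)) =
  if does (d ∣? n)
  then ((((-K 1K) ^K d) *K (g (n ℕ./ d) ^K d)) ÷ fromℕ d)
  else 0K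

divSum : (ℕ → K) → ℕ → K
divSum g n = sumK (map (divTerm g n) (upTo (suc n)))

{-# OPTIONS --safe #-}

-- Coefficients are compared through logarithmic derivatives. If P = ∏(1 + gₙxⁿ) then
-- x·P′ = L·P, where the coefficient of xᵐ in L is Σ_{d∣m} (-1)ᵈ⁻¹ (m/d) g_{m/d}ᵈ. The
-- q-derivation xⁿ ↦ [n]xⁿ satisfies a twisted Leibniz rule and maps exp_q(x) to x·exp_q(x);
-- from this x·exp_q′ = C·exp_q with Cₙ = (1-q)ⁿ⁻¹/[n], and the first recurrence is L = C. As
-- Exp_q = exp_{1/q}, the second one is the first with 1/q for q. Divisors of odd numbers are
-- odd, so at odd indices the recurrences for eₙ, Eₙ and the image of eₙ under q ↦ 1/q are
-- self-contained; there they coincide, because (1-q)ⁿ⁻¹ = (q-1)ⁿ⁻¹ for odd n.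
module Submission where

open import Algebra.Bundles using (CommutativeRing; CommutativeSemiring; RawRing)
import Algebra.Construct.Pointwise as Pointwise
open import Algebra.Morphism.Structures using (module RingMorphisms)
import Algebra.Properties.CommutativeSemigroup as CommutativeSemigroupProperties
import Algebra.Properties.CommutativeSemiring.Exp as SemiringExp
import Algebra.Properties.Ring as RingProperties
import Algebra.Properties.Semiring.Mult as SemiringMult
import Algebra.Solver.Ring.NaturalCoefficients.Default as NaturalSolver
open import Data.Bool using (true; false; if_then_else_)
open import Data.Nat as ℕ using (ℕ; zero; suc; _≤_; _<_; z≤n; s≤s; _∸_)
open import Data.Nat.DivMod using (m*n/n≡m)
open import Data.Nat.Divisibility as Div using (_∣?_; _∣_; divides)
open import Data.Nat.Induction using (<-rec)
import Data.Nat.Properties as ℕₚ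
open import Data.Product using (_×_; _,_)
open import Data.Sum using (_⊎_; inj₁; inj₂)
open import Function using (_∘_; const)
import Level
open import Relation.Binary.PropositionalEquality as ≡ using (_≡_; _≢_)
import Relation.Binary.Reasoning.Setoid as SetoidReasoning
open import Relation.Binary.Structures using (IsEquivalence)
open import Relation.Nullary using (¬_; Dec; yes; no; does; contradiction)
open import Relation.Nullary.Decidable using (dec-true; dec-false)

-- Formal power series and power products over a commutative ring

-- The argument divides only by positive integers, by brackets [n] and by q, so it is carried out
-- over an arbitrary commutative ring in which these are invertible. Differences such as u = 1 - t
-- enter as `u + t ≈ 1#`, which keeps the identities within reach of a semiring solver.
--
-- The obstacle is the passage to `K`: its elements are raw pairs, and `_≈_` is not transitive on
-- them, because 0/0 is equivalent to everything. Hence the ring `ℚ⟨q⟩` of fractions with a proof of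
-- validity, whose operations have those of `K` as first component. Most expressions of the theorem
-- are then literally the underlying fractions of ring elements, and results transfer without
-- computation in `K`.
--
-- No infinite product is formed. The first n factors agree with f up to order n, so coefficient n
-- of the logarithmic derivative is read off from n factors, and f is cancelled up to that order
-- only.
--
-- The choice [n]Cₙ = (1-q)ⁿ⁻¹ works because it makes the twist qⁿCₙ equal to Cₙ - (1-q)ⁿ for n ≥ 1;
-- the twisted Leibniz rule then closes up in C itself.

module PowerSeries {c ℓ} (R : CommutativeRing c ℓ) where
  open CommutativeRing R
  open SetoidReasoning setoid
  open NaturalSolver commutativeSemiring using (solve; _:=_; _:+_; _:*_)

  Series : Set c
  Series = ℕ → Carrier

  infix 4 _≋_
  _≋_ : Series → Series → Set ℓ
  f ≋ g = ∀ n → f n ≈ g n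

  infixl 6 _⊕_
  infixl 7 _⊛_ _·_

  _⊕_ : Series → Series → Series
  (f ⊕ g) n = f n + g n

  _·_ : Carrier → Series → Series
  (a · f) n = a * f n

  -- Convolution by recursion on f = f₀ + x·(f ∘ suc), so that the laws below follow by induction
  -- with the tail in place of f.
  _⊛_ : Series → Series → Series
  (f ⊛ g) zero    = f 0 * g 0
  (f ⊛ g) (suc n) = f 0 * g (suc n) + (f ∘ suc ⊛ g) n

  one : Series
  one zero    = 1#
  one (suc n) = 0#

  -- The bound matters: a partial product agrees with its target series only up to a given order.
  ⊛-cong-≤ : ∀ n {f f′ g g′} → (∀ i → i ≤ n → f i ≈ f′ i) → (∀ i → i ≤ n → g i ≈ g′ i) →
             (f ⊛ g) n ≈ (f′ ⊛ g′) n
  ⊛-cong-≤ zero    p r = *-cong (p 0 z≤n) (r 0 z≤n)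
  ⊛-cong-≤ (suc n) p r = +-cong (*-cong (p 0 z≤n) (r (suc n) (s≤s ℕₚ.≤-refl)))
    (⊛-cong-≤ n (λ i i≤n → p (suc i) (s≤s i≤n)) (λ i i≤n → r i (ℕₚ.m≤n⇒m≤1+n i≤n)))

  ⊛-cong : ∀ {f f′ g g′} → f ≋ f′ → g ≋ g′ → f ⊛ g ≋ f′ ⊛ g′
  ⊛-cong p r n = ⊛-cong-≤ n (λ i _ → p i) (λ i _ → r i)

  ⊛-zeroˡ : ∀ f → const 0# ⊛ f ≋ const 0#
  ⊛-zeroˡ f zero    = zeroˡ _
  ⊛-zeroˡ f (suc n) = trans (+-cong (zeroˡ _) (⊛-zeroˡ f n)) (+-identityˡ _)

  ⊛-distribʳ : ∀ h f g → (f ⊕ g) ⊛ h ≋ (f ⊛ h) ⊕ (g ⊛ h)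
  ⊛-distribʳ h f g zero    = distribʳ _ _ _
  ⊛-distribʳ h f g (suc n) = trans (+-congˡ (⊛-distribʳ h (f ∘ suc) (g ∘ suc) n))
    (solve 5 (λ a b x u v → (a :+ b) :* x :+ (u :+ v) := (a :* x :+ u) :+ (b :* x :+ v)) refl _ _ _ _ _)

  ⊛-distribˡ : ∀ h f g → h ⊛ (f ⊕ g) ≋ (h ⊛ f) ⊕ (h ⊛ g)
  ⊛-distribˡ h f g zero    = distribˡ _ _ _
  ⊛-distribˡ h f g (suc n) = trans (+-congˡ (⊛-distribˡ (h ∘ suc) f g n))
    (solve 5 (λ x a b u v → x :* (a :+ b) :+ (u :+ v) := (x :* a :+ u) :+ (x :* b :+ v)) refl _ _ _ _ _)

  ·-⊛ : ∀ a f g → (a · f) ⊛ g ≋ a · (f ⊛ g)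
  ·-⊛ a f g zero    = *-assoc _ _ _
  ·-⊛ a f g (suc n) = trans (+-congˡ (·-⊛ a (f ∘ suc) g n))
    (solve 4 (λ a x y z → a :* x :* y :+ a :* z := a :* (x :* y :+ z)) refl _ _ _ _)

  ⊛-· : ∀ a f g → f ⊛ (a · g) ≋ a · (f ⊛ g)
  ⊛-· a f g zero    = solve 3 (λ a x y → x :* (a :* y) := a :* (x :* y)) refl _ _ _
  ⊛-· a f g (suc n) = trans (+-congˡ (⊛-· a (f ∘ suc) g n))
    (solve 4 (λ a x y z → x :* (a :* y) :+ a :* z := a :* (x :* y :+ z)) refl _ _ _ _)

  ⊛-identityˡ : ∀ f → one ⊛ f ≋ f
  ⊛-identityˡ f zero    = *-identityˡ _
  ⊛-identityˡ f (suc n) = trans (+-cong (*-identityˡ _) (⊛-zeroˡ f n)) (+-identityʳ _)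

  -- The defining recursion seen from the other factor; it supplies the symmetry that commutativity
  -- needs.
  ⊛-suc : ∀ f g n → (f ⊛ g) (suc n) ≈ (f ⊛ g ∘ suc) n + f (suc n) * g 0
  ⊛-suc f g zero    = refl
  ⊛-suc f g (suc n) = trans (+-congˡ (⊛-suc (f ∘ suc) g n)) (sym (+-assoc _ _ _))

  ⊛-comm : ∀ f g → f ⊛ g ≋ g ⊛ f
  ⊛-comm f g zero    = *-comm _ _
  ⊛-comm f g (suc n) = begin
    f 0 * g (suc n) + (f ∘ suc ⊛ g) n  ≈⟨ +-cong (*-comm _ _) (⊛-comm (f ∘ suc) g n) ⟩
    g (suc n) * f 0 + (g ⊛ f ∘ suc) n  ≈⟨ +-comm _ _ ⟩
    (g ⊛ f ∘ suc) n + g (suc n) * f 0  ≈⟨ ⊛-suc g f n ⟨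
    (g ⊛ f) (suc n)                    ∎

  ⊛-assoc : ∀ f g h → (f ⊛ g) ⊛ h ≋ f ⊛ (g ⊛ h)
  ⊛-assoc f g h zero    = *-assoc _ _ _
  ⊛-assoc f g h (suc n) = begin
    f 0 * g 0 * h (suc n) + ((f 0 · (g ∘ suc) ⊕ (f ∘ suc ⊛ g)) ⊛ h) n
      ≈⟨ +-congˡ (⊛-distribʳ h (f 0 · (g ∘ suc)) (f ∘ suc ⊛ g) n) ⟩
    f 0 * g 0 * h (suc n) + ((f 0 · (g ∘ suc) ⊛ h) n + ((f ∘ suc ⊛ g) ⊛ h) n)
      ≈⟨ +-congˡ (+-cong (·-⊛ (f 0) (g ∘ suc) h n) (⊛-assoc (f ∘ suc) g h n)) ⟩
    f 0 * g 0 * h (suc n) + (f 0 * (g ∘ suc ⊛ h) n + (f ∘ suc ⊛ (g ⊛ h)) n)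
      ≈⟨ solve 5 (λ a b x u v → a :* b :* x :+ (a :* u :+ v) := a :* (b :* x :+ u) :+ v) refl _ _ _ _ _ ⟩
    f 0 * (g 0 * h (suc n) + (g ∘ suc ⊛ h) n) + (f ∘ suc ⊛ (g ⊛ h)) n ∎

  seriesRing : CommutativeRing c ℓ
  seriesRing = record
    { Carrier = Series ; _≈_ = _≋_ ; _+_ = _⊕_ ; _*_ = _⊛_ ; -_ = -_ ∘_ ; 0# = const 0# ; 1# = one
    ; isCommutativeRing = record
      { isRing = record
        { +-isAbelianGroup = Pointwise.isAbelianGroup ℕ +-isAbelianGroup
        ; *-cong = ⊛-cong
        ; *-assoc = ⊛-assoc
        ; *-identity = ⊛-identityˡ , λ f n → trans (⊛-comm f one n) (⊛-identityˡ f n)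
        ; distrib = ⊛-distribˡ , ⊛-distribʳ
        }
      ; *-comm = ⊛-comm
      }
    }

  -- With constant term 1 the system for the coefficients is triangular, so agreement of the
  -- products up to order n already determines coefficient n.
  ⊛-cancelʳ : ∀ h → h 0 ≈ 1# → ∀ n f g → (∀ i → i ≤ n → (f ⊛ h) i ≈ (g ⊛ h) i) → f n ≈ g n
  ⊛-cancelʳ h h₀ n f g eq = cancel n f g eq
    where
    open RingProperties ring using (+-cancelˡ)
    head : ∀ n f g → (∀ i → i ≤ n → (f ⊛ h) i ≈ (g ⊛ h) i) → f 0 ≈ g 0
    head n f g eq = begin
      f 0       ≈⟨ *-identityʳ _ ⟨
      f 0 * 1#  ≈⟨ *-congˡ h₀ ⟨
      f 0 * h 0 ≈⟨ eq 0 z≤n ⟩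
      g 0 * h 0 ≈⟨ *-congˡ h₀ ⟩
      g 0 * 1#  ≈⟨ *-identityʳ _ ⟩
      g 0       ∎
    cancel : ∀ n f g → (∀ i → i ≤ n → (f ⊛ h) i ≈ (g ⊛ h) i) → f n ≈ g n
    cancel zero    f g eq = head 0 f g eq
    -- Since the constant terms agree, both products have the same first summand in degree i + 1;
    -- removing it leaves the hypothesis for the tails.
    cancel (suc n) f g eq = cancel n (f ∘ suc) (g ∘ suc) λ i i≤n →
      +-cancelˡ (f 0 * h (suc i)) _ _
        (trans (eq (suc i) (s≤s i≤n)) (+-congʳ (*-congʳ (sym (head (suc n) f g eq)))))

  -- Multiplication by xᵏ.
  shift : ℕ → Series → Series
  shift zero    f n       = f n
  shift (suc k) f zero    = 0#
  shift (suc k) f (suc n) = shift k f n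

  shift-cong : ∀ k {f g} → f ≋ g → shift k f ≋ shift k g
  shift-cong zero    p n       = p n
  shift-cong (suc k) p zero    = refl
  shift-cong (suc k) p (suc n) = shift-cong k p n

  shift-≤ : ∀ k f {n} → k ≤ n → shift k f n ≈ f (n ∸ k)
  shift-≤ zero    f k≤n       = refl
  shift-≤ (suc k) f (s≤s k≤n) = shift-≤ k f k≤n

  shift-< : ∀ k f {n} → n < k → shift k f n ≈ 0#
  shift-< (suc k) f {zero}  n<k       = refl
  shift-< (suc k) f {suc n} (s≤s n<k) = shift-< k f n<k

  shift-⊛ : ∀ k f g → shift k f ⊛ g ≋ shift k (f ⊛ g)
  shift-⊛ zero    f g n       = refl
  shift-⊛ (suc k) f g zero    = zeroˡ _
  shift-⊛ (suc k) f g (suc n) = trans (+-cong (zeroˡ _) (shift-⊛ k f g n)) (+-identityˡ _)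

  ⊛-shift : ∀ k f g → f ⊛ shift k g ≋ shift k (f ⊛ g)
  ⊛-shift k f g n = begin
    (f ⊛ shift k g) n ≈⟨ ⊛-comm f (shift k g) n ⟩
    (shift k g ⊛ f) n ≈⟨ shift-⊛ k g f n ⟩
    shift k (g ⊛ f) n ≈⟨ shift-cong k (⊛-comm g f) n ⟩
    shift k (f ⊛ g) n ∎

  -- Covers both the derivation x·d/dx (w n = n, s n = 1) and the q-derivation (w n = [n], s n = qⁿ).
  twisted-leibniz : ∀ (w s : Series) → w 0 ≈ 0# → (∀ k n → w (k ℕ.+ n) ≈ w k + s k * w n) →
    ∀ f g n → w n * (f ⊛ g) n ≈ ((λ k → w k * f k) ⊛ g) n + ((λ k → s k * f k) ⊛ (λ k → w k * g k)) n
  twisted-leibniz w s w₀ w+ = go 0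
    where

    -- Peeling the head of f lowers its indices by one while the weights must keep the original
    -- ones; the offset `c` counts what has been peeled.
    go : ∀ c f g n → w (c ℕ.+ n) * (f ⊛ g) n ≈
         ((λ k → w (c ℕ.+ k) * f k) ⊛ g) n + ((λ k → s (c ℕ.+ k) * f k) ⊛ (λ k → w k * g k)) n
    go c f g zero    = begin
      w (c ℕ.+ 0) * (f 0 * g 0)
        ≈⟨ solve 3 (λ w x y → w :* (x :* y) := w :* x :* y) refl _ _ _ ⟩
      w (c ℕ.+ 0) * f 0 * g 0
        ≈⟨ +-identityʳ _ ⟨
      w (c ℕ.+ 0) * f 0 * g 0 + 0#
        ≈⟨ +-congˡ (trans (*-congˡ (trans (*-congʳ w₀) (zeroˡ _))) (zeroʳ _)) ⟨
      w (c ℕ.+ 0) * f 0 * g 0 + s (c ℕ.+ 0) * f 0 * (w 0 * g 0) ∎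
    go c f g (suc n) = begin
      w (c ℕ.+ suc n) * (f 0 * g (suc n) + (f ∘ suc ⊛ g) n)
        ≈⟨ distribˡ _ _ _ ⟩
      w (c ℕ.+ suc n) * (f 0 * g (suc n)) + w (c ℕ.+ suc n) * (f ∘ suc ⊛ g) n
        ≈⟨ +-cong (*-congʳ (trans (w+ c (suc n)) (+-cong (w≡ (ℕₚ.+-identityʳ c)) (*-congʳ (s≡ (ℕₚ.+-identityʳ c))))))
             (trans (*-congʳ (sym (w≡ (ℕₚ.+-suc c n)))) (go (suc c) (f ∘ suc) g n)) ⟩
      (w (c ℕ.+ 0) + s (c ℕ.+ 0) * w (suc n)) * (f 0 * g (suc n))
        + (((λ k → w (suc c ℕ.+ k) * f (suc k)) ⊛ g) n + ((λ k → s (suc c ℕ.+ k) * f (suc k)) ⊛ (λ k → w k * g k)) n)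
        ≈⟨ +-congˡ (+-cong (⊛-cong (λ k → *-congʳ (w≡ (ℕₚ.+-suc c k))) (λ _ → refl) n)
                           (⊛-cong (λ k → *-congʳ (s≡ (ℕₚ.+-suc c k))) (λ _ → refl) n)) ⟩
      (w (c ℕ.+ 0) + s (c ℕ.+ 0) * w (suc n)) * (f 0 * g (suc n))
        + (((λ k → w (c ℕ.+ suc k) * f (suc k)) ⊛ g) n + ((λ k → s (c ℕ.+ suc k) * f (suc k)) ⊛ (λ k → w k * g k)) n)
        ≈⟨ solve 7 (λ a s b x y u v → (a :+ s :* b) :* (x :* y) :+ (u :+ v) := (a :* x :* y :+ u) :+ (s :* x :* (b :* y) :+ v))
             refl _ _ _ _ _ _ _ ⟩
      _ ∎
      where
      w≡ : ∀ {i j} → i ≡ j → w j ≈ w i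
      w≡ ≡.refl = refl
      s≡ : ∀ {i j} → i ≡ j → s j ≈ s i
      s≡ ≡.refl = refl

-- Finite sums over initial segments of ℕ

module Sums {c ℓ} (R : CommutativeRing c ℓ) where
  open CommutativeRing R
  open NaturalSolver commutativeSemiring using (solve; _:=_; _:+_; _:*_)

  sum : ℕ → (ℕ → Carrier) → Carrier
  sum zero    f = 0#
  sum (suc n) f = f 0 + sum n (f ∘ suc)

  sum-cong : ∀ n {f g} → (∀ i → i < n → f i ≈ g i) → sum n f ≈ sum n g
  sum-cong zero    p = refl
  sum-cong (suc n) p = +-cong (p 0 (s≤s z≤n)) (sum-cong n λ i i<n → p (suc i) (s≤s i<n))

  sum-zero : ∀ n {f} → (∀ i → i < n → f i ≈ 0#) → sum n f ≈ 0#
  sum-zero zero    p = refl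
  sum-zero (suc n) p = trans (+-cong (p 0 (s≤s z≤n)) (sum-zero n λ i i<n → p (suc i) (s≤s i<n))) (+-identityˡ 0#)

  sum-single : ∀ n e f → e < n → (∀ i → i ≢ e → f i ≈ 0#) → sum n f ≈ f e
  sum-single (suc n) zero    f e<n       p =
    trans (+-congˡ (sum-zero n λ i _ → p (suc i) λ ())) (+-identityʳ _)
  sum-single (suc n) (suc e) f (s≤s e<n) p =
    trans (+-cong (p 0 λ ()) (sum-single n e (f ∘ suc) e<n λ i i≢e → p (suc i) (i≢e ∘ ℕₚ.suc-injective))) (+-identityˡ _)

  sum-+ : ∀ n f g → sum n (λ i → f i + g i) ≈ sum n f + sum n g
  sum-+ zero    f g = sym (+-identityˡ 0#)
  sum-+ (suc n) f g = trans (+-congˡ (sum-+ n (f ∘ suc) (g ∘ suc)))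
    (solve 4 (λ a b x y → a :+ b :+ (x :+ y) := a :+ x :+ (b :+ y)) refl _ _ _ _)

  *-sum : ∀ n a f → a * sum n f ≈ sum n (λ i → a * f i)
  *-sum zero    a f = zeroʳ a
  *-sum (suc n) a f = trans (distribˡ _ _ _) (+-congˡ (*-sum n a (f ∘ suc)))

  sum-swap : ∀ m n (f : ℕ → ℕ → Carrier) → sum m (λ i → sum n (f i)) ≈ sum n (λ j → sum m (λ i → f i j))
  sum-swap zero    n f = sym (sum-zero n λ _ _ → refl)
  sum-swap (suc m) n f = trans (+-congˡ (sum-swap m n (f ∘ suc)))
    (sym (sum-+ n (f 0) (λ j → sum m (λ i → f (suc i) j))))

  sum-split : ∀ m n f → sum (m ℕ.+ n) f ≈ sum m f + sum n (λ i → f (m ℕ.+ i))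
  sum-split zero    n f = sym (+-identityˡ _)
  sum-split (suc m) n f = trans (+-congˡ (sum-split m n (f ∘ suc))) (sym (+-assoc _ _ _))

  sum-last : ∀ n f → sum (suc n) f ≈ sum n f + f n
  sum-last zero    f = +-comm _ _
  sum-last (suc n) f = trans (+-congˡ (sum-last n (f ∘ suc))) (sym (+-assoc _ _ _))

-- The q-derivation and series satisfying q-difference recurrences

module QAnalogs {c ℓ} (R : CommutativeRing c ℓ) (t : CommutativeRing.Carrier R) where
  open CommutativeRing R
  open SetoidReasoning setoid
  open NaturalSolver commutativeSemiring using (solve; _:=_; _:+_; _:*_)
  open RingProperties ring using (+-cancelʳ; -1*x≈-x)
  open SemiringExp commutativeSemiring using (_^_; ^-homo-*)
  open SemiringMult semiring using () renaming (_×_ to _×ᴿ_)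
  open PowerSeries R
  open Sums R

  [_] : ℕ → Carrier
  [ n ] = sum n (t ^_)

  [m+n] : ∀ m n → [ m ℕ.+ n ] ≈ [ m ] + t ^ m * [ n ]
  [m+n] m n = trans (sum-split m n (t ^_)) (+-congˡ (trans (sum-cong n λ i _ → ^-homo-* t m i)
    (sym (*-sum n (t ^ m) (t ^_)))))

  -- The geometric sum (1-t)[n] = 1 - tⁿ without subtraction: after adding t[n], both sides become
  -- [n+1].
  [n]-telescope : ∀ u → u + t ≈ 1# → ∀ n → t ^ n + u * [ n ] ≈ 1#
  [n]-telescope u u+t n = +-cancelʳ (t * [ n ]) _ _ (begin
    t ^ n + u * [ n ] + t * [ n ]
      ≈⟨ solve 4 (λ a u t s → a :+ u :* s :+ t :* s := (u :+ t) :* s :+ a) refl _ _ _ _ ⟩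
    (u + t) * [ n ] + t ^ n        ≈⟨ +-congʳ (trans (*-congʳ u+t) (*-identityˡ _)) ⟩
    [ n ] + t ^ n                  ≈⟨ sum-last n (t ^_) ⟨
    1# + sum n (λ i → t * t ^ i)   ≈⟨ +-congˡ (*-sum n t (t ^_)) ⟨
    1# + t * [ n ]                 ∎)

  q-leibniz : ∀ f g n → [ n ] * (f ⊛ g) n ≈
    ((λ k → [ k ] * f k) ⊛ g) n + ((λ k → t ^ k * f k) ⊛ (λ k → [ k ] * g k)) n
  q-leibniz = twisted-leibniz [_] (t ^_) refl [m+n]

  module _ ([]-cancel : ∀ n {x y} → [ suc n ] * x ≈ [ suc n ] * y → x ≈ y) where

    -- The right-hand side is the logarithmic derivative Σ uᵏ⁻¹xᵏ/[k]; comparing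
    -- q-derivatives gives [n+1]Gₙ₊₁ = fₙ + Gₙ for G = C·f.
    exp-log-derivative : ∀ u → u + t ≈ 1# → ∀ f C →
      (∀ n → [ suc n ] * f (suc n) ≈ f n) →
      C 0 ≈ 0# → (∀ n → [ suc n ] * C (suc n) ≈ u ^ n) →
      ∀ n → (n ×ᴿ 1#) * f n ≈ (C ⊛ f) n
    exp-log-derivative u u+t f C f-suc C₀ C-suc = go
      where
      geo : Series
      geo = u ^_
      Qf : (λ k → [ k ] * f k) ≋ shift 1 f
      Qf zero    = zeroˡ _
      Qf (suc n) = f-suc n
      QC : (λ k → [ k ] * C k) ≋ shift 1 geo
      QC zero    = zeroˡ _
      QC (suc n) = C-suc n
      geo-unfold : geo ≋ one ⊕ u · shift 1 geo
      geo-unfold zero    = sym (trans (+-congˡ (zeroʳ u)) (+-identityʳ _))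
      geo-unfold (suc n) = sym (+-identityˡ _)
      SC : Series
      SC k = t ^ k * C k
      -- The twist in the Leibniz rule changes C only by u·x/(1-ux); the head 1 of the geometric
      -- series then remains and contributes the summand fₙ of the recurrence.
      SC-unfold : u · shift 1 geo ⊕ SC ≋ C
      SC-unfold n = begin
        u * shift 1 geo n + t ^ n * C n  ≈⟨ +-congʳ (*-congˡ (QC n)) ⟨
        u * ([ n ] * C n) + t ^ n * C n
          ≈⟨ solve 4 (λ u b c s → u :* (b :* c) :+ s :* c := (s :+ u :* b) :* c) refl _ _ _ _ ⟩
        (t ^ n + u * [ n ]) * C n        ≈⟨ *-congʳ ([n]-telescope u u+t n) ⟩
        1# * C n                         ≈⟨ *-identityˡ _ ⟩
        C n                              ∎
      recurrence : ∀ n → [ suc n ] * (C ⊛ f) (suc n) ≈ f n + (C ⊛ f) n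
      recurrence n = begin
        [ suc n ] * (C ⊛ f) (suc n)
          ≈⟨ q-leibniz C f (suc n) ⟩
        ((λ k → [ k ] * C k) ⊛ f) (suc n) + (SC ⊛ (λ k → [ k ] * f k)) (suc n)
          ≈⟨ +-cong (⊛-cong {g = f} QC (λ _ → refl) (suc n)) (⊛-cong {f = SC} (λ _ → refl) Qf (suc n)) ⟩
        (shift 1 geo ⊛ f) (suc n) + (SC ⊛ shift 1 f) (suc n)
          ≈⟨ +-cong (shift-⊛ 1 geo f (suc n)) (⊛-shift 1 SC f (suc n)) ⟩
        (geo ⊛ f) n + (SC ⊛ f) n
          ≈⟨ +-congʳ (trans (⊛-cong {g = f} geo-unfold (λ _ → refl) n) (⊛-distribʳ f one (u · shift 1 geo) n)) ⟩
        (one ⊛ f) n + (u · shift 1 geo ⊛ f) n + (SC ⊛ f) n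
          ≈⟨ +-assoc _ _ _ ⟩
        (one ⊛ f) n + ((u · shift 1 geo ⊛ f) n + (SC ⊛ f) n)
          ≈⟨ +-cong (⊛-identityˡ f n) (sym (⊛-distribʳ f (u · shift 1 geo) SC n)) ⟩
        f n + ((u · shift 1 geo ⊕ SC) ⊛ f) n
          ≈⟨ +-congˡ (⊛-cong {g = f} SC-unfold (λ _ → refl) n) ⟩
        f n + (C ⊛ f) n ∎
      go : ∀ n → (n ×ᴿ 1#) * f n ≈ (C ⊛ f) n
      go zero    = trans (zeroˡ _) (sym (trans (*-congʳ C₀) (zeroˡ _)))
      -- The sequence n·fₙ obeys the recurrence just found for C·f, because (n+1)fₙ = fₙ + n·fₙ.
      go (suc n) = []-cancel n (begin
        [ suc n ] * ((1# + n ×ᴿ 1#) * f (suc n))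
          ≈⟨ solve 3 (λ a b x → a :* (b :* x) := b :* (a :* x)) refl _ _ _ ⟩
        (1# + n ×ᴿ 1#) * ([ suc n ] * f (suc n))
          ≈⟨ *-congˡ (f-suc n) ⟩
        (1# + n ×ᴿ 1#) * f n
          ≈⟨ trans (distribʳ _ _ _) (+-congʳ (*-identityˡ _)) ⟩
        f n + (n ×ᴿ 1#) * f n
          ≈⟨ +-congˡ (go n) ⟩
        f n + (C ⊛ f) n
          ≈⟨ recurrence n ⟨
        [ suc n ] * (C ⊛ f) (suc n) ∎)

    -- The q-derivative of the product vanishes.
    Exp-inverse : ∀ E ē → E 0 * ē 0 ≈ 1# →
      (∀ n → [ suc n ] * E (suc n) ≈ t ^ n * E n) →
      (∀ n → [ suc n ] * ē (suc n) ≈ - 1# * ē n) →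
      E ⊛ ē ≋ one
    Exp-inverse E ē E₀ē₀ E-suc ē-suc zero    = E₀ē₀
    Exp-inverse E ē E₀ē₀ E-suc ē-suc (suc n) = []-cancel n (begin
      [ suc n ] * (E ⊛ ē) (suc n)
        ≈⟨ q-leibniz E ē (suc n) ⟩
      ((λ k → [ k ] * E k) ⊛ ē) (suc n) + (SE ⊛ (λ k → [ k ] * ē k)) (suc n)
        ≈⟨ +-cong (⊛-cong {g = ē} QE (λ _ → refl) (suc n)) (⊛-cong {f = SE} (λ _ → refl) Qē (suc n)) ⟩
      (shift 1 SE ⊛ ē) (suc n) + (SE ⊛ (- 1# · shift 1 ē)) (suc n)
        ≈⟨ +-cong (shift-⊛ 1 SE ē (suc n))
             (trans (⊛-· (- 1#) SE (shift 1 ē) (suc n)) (*-congˡ (⊛-shift 1 SE ē (suc n)))) ⟩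
      (SE ⊛ ē) n + - 1# * (SE ⊛ ē) n
        ≈⟨ trans (+-congˡ (-1*x≈-x _)) (-‿inverseʳ _) ⟩
      0#
        ≈⟨ zeroʳ _ ⟨
      [ suc n ] * 0# ∎)
      where
      SE : Series
      SE k = t ^ k * E k
      QE : (λ k → [ k ] * E k) ≋ shift 1 SE
      QE zero    = zeroˡ _
      QE (suc k) = E-suc k
      Qē : (λ k → [ k ] * ē k) ≋ - 1# · shift 1 ē
      Qē zero    = trans (zeroˡ _) (sym (zeroʳ _))
      Qē (suc k) = ē-suc k

-- Power products, their logarithmic derivatives and the divisor recurrence

module PowerProducts {c ℓ} (R : CommutativeRing c ℓ) (g : ℕ → CommutativeRing.Carrier R) where
  open CommutativeRing R
  open SetoidReasoning setoid
  open NaturalSolver commutativeSemiring using (solve; _:=_; _:+_; _:*_)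
  open RingProperties ring using (-1*x≈-x)
  open SemiringExp commutativeSemiring using (_^_; ^-distrib-*; ^-congˡ)
  open SemiringMult semiring using (×-homo-+; ×1-homo-*) renaming (_×_ to _×ᴿ_)
  open PowerSeries R
  open Sums R

  D : Series → Series
  D f n = (n ×ᴿ 1#) * f n

  partialProduct : ℕ → Series
  partialProduct zero    = one
  partialProduct (suc N) = partialProduct N ⊕ g (suc N) · shift (suc N) (partialProduct N)

  D-shift : ∀ k f → D (shift k f) ≋ shift k (D f) ⊕ (k ×ᴿ 1#) · shift k f
  D-shift k f n with ℕₚ.≤-<-connex k n
  ... | inj₁ k≤n = begin
    (n ×ᴿ 1#) * shift k f n
      ≡⟨ ≡.cong (λ j → (j ×ᴿ 1#) * shift k f n) (ℕₚ.m∸n+n≡m k≤n) ⟨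
    ((n ∸ k ℕ.+ k) ×ᴿ 1#) * shift k f n
      ≈⟨ trans (*-congʳ (×-homo-+ 1# (n ∸ k) k)) (distribʳ _ _ _) ⟩
    ((n ∸ k) ×ᴿ 1#) * shift k f n + (k ×ᴿ 1#) * shift k f n
      ≈⟨ +-congʳ (trans (*-congˡ (shift-≤ k f k≤n)) (sym (shift-≤ k (D f) k≤n))) ⟩
    shift k (D f) n + (k ×ᴿ 1#) * shift k f n ∎
  ... | inj₂ n<k = begin
    (n ×ᴿ 1#) * shift k f n                     ≈⟨ trans (*-congˡ (shift-< k f n<k)) (zeroʳ _) ⟩
    0#                                          ≈⟨ +-identityˡ 0# ⟨
    0# + 0#                                     ≈⟨ +-cong (shift-< k (D f) n<k) (trans (*-congˡ (shift-< k f n<k)) (zeroʳ _)) ⟨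
    shift k (D f) n + (k ×ᴿ 1#) * shift k f n   ∎

  -- The coefficient of xⁿᵈ in the logarithmic derivative n g xⁿ / (1 + g xⁿ) of 1 + gxⁿ, g = gₙ.
  τ : ℕ → ℕ → Carrier
  τ n zero    = 0#
  τ n (suc d) = (n ×ᴿ 1#) * g n * (- g n) ^ d

  indicator : ℕ → ℕ → ℕ → Carrier
  indicator n m d = if does (d ℕ.* n ℕ.≟ m) then τ n d else 0#

  indicator-≡ : ∀ n m d → d ℕ.* n ≡ m → indicator n m d ≡ τ n d
  indicator-≡ n m d eq = ≡.cong (if_then τ n d else 0#) (dec-true (d ℕ.* n ℕ.≟ m) eq)

  indicator-≢ : ∀ n m d → d ℕ.* n ≢ m → indicator n m d ≡ 0#
  indicator-≢ n m d ¬eq = ≡.cong (if_then τ n d else 0#) (dec-false (d ℕ.* n ℕ.≟ m) ¬eq)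

  -- The logarithmic derivative n g xⁿ / (1 + g xⁿ) of a single factor. For n ≥ 1 at most one d
  -- contributes; writing the coefficient as a sum over d prepares the exchange of summations over
  -- factors and exponents.
  T : ℕ → Series
  T n m = sum (suc m) (indicator n m)

  T-multiple : ∀ n d → T (suc n) (d ℕ.* suc n) ≈ τ (suc n) d
  T-multiple n d = trans
    (sum-single (suc (d ℕ.* suc n)) d (indicator (suc n) (d ℕ.* suc n)) (s≤s (ℕₚ.m≤m*n d (suc n)))
      λ i i≢d → reflexive (indicator-≢ (suc n) _ i λ eq → i≢d (ℕₚ.*-cancelʳ-≡ i d (suc n) eq)))
    (reflexive (indicator-≡ (suc n) _ d ≡.refl))

  T-∤ : ∀ n {m} → ¬ (n ∣ m) → T n m ≈ 0#
  T-∤ n {m} n∤m = sum-zero (suc m) λ d _ → reflexive (indicator-≢ n m d λ eq → n∤m (divides d (≡.sym eq)))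

  -- The division-free form of T = n g xⁿ / (1 + g xⁿ). Along the multiples of n the coefficients of
  -- T are geometric with ratio -g, so consecutive ones cancel and only the first survives.
  T-equation : ∀ n → T (suc n) ⊕ g (suc n) · shift (suc n) (T (suc n))
                     ≋ (suc n ×ᴿ 1#) * g (suc n) · shift (suc n) one
  T-equation n′ m with ℕₚ.≤-<-connex (suc n′) m
  ... | inj₂ m<n = begin
    T n m + g n * shift n (T n) m  ≈⟨ +-cong T≈0 (trans (*-congˡ (shift-< n (T n) m<n)) (zeroʳ _)) ⟩
    0# + 0#                        ≈⟨ +-identityˡ 0# ⟩
    0#                             ≈⟨ trans (*-congˡ (shift-< n one m<n)) (zeroʳ _) ⟨
    (n ×ᴿ 1#) * g n * shift n one m  ∎
    where
    n = suc n′
    T≈0 : T n m ≈ 0#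
    T≈0 with n ∣? m
    ... | no n∤m = T-∤ n n∤m
    ... | yes (divides zero ≡.refl) = T-multiple n′ 0
    ... | yes (divides (suc d) ≡.refl) = contradiction m<n (ℕₚ.≤⇒≯ (ℕₚ.m≤m+n n (d ℕ.* n)))
  ... | inj₁ n≤m = begin
    T n m + g n * shift n (T n) m    ≈⟨ +-congˡ (*-congˡ (shift-≤ n (T n) n≤m)) ⟩
    T n m + g n * T n (m ∸ n)        ≈⟨ go (m ∸ n) (≡.sym (ℕₚ.m+[n∸m]≡n n≤m)) ⟩
    (n ×ᴿ 1#) * g n * one (m ∸ n)    ≈⟨ *-congˡ (shift-≤ n one n≤m) ⟨
    (n ×ᴿ 1#) * g n * shift n one m  ∎
    where
    n = suc n′
    go : ∀ k → m ≡ n ℕ.+ k → T n m + g n * T n k ≈ (n ×ᴿ 1#) * g n * one k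
    go k ≡.refl with n ∣? k
    go .0 ≡.refl | yes (divides zero ≡.refl) = begin
      T n (n ℕ.+ 0) + g n * T n 0    ≈⟨ +-cong (T-multiple n′ 1) (trans (*-congˡ (T-multiple n′ 0)) (zeroʳ _)) ⟩
      (n ×ᴿ 1#) * g n * 1# + 0#      ≈⟨ +-identityʳ _ ⟩
      (n ×ᴿ 1#) * g n * 1#           ∎
    go .(suc d ℕ.* n) ≡.refl | yes (divides (suc d) ≡.refl) = begin
      T n (suc (suc d) ℕ.* n) + g n * T n (suc d ℕ.* n)
        ≈⟨ +-cong (T-multiple n′ (suc (suc d))) (*-congˡ (T-multiple n′ (suc d))) ⟩
      (n ×ᴿ 1#) * g n * (- g n * (- g n) ^ d) + g n * ((n ×ᴿ 1#) * g n * (- g n) ^ d)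
        ≈⟨ solve 4 (λ a x y p → a :* x :* (y :* p) :+ x :* (a :* x :* p) := a :* x :* p :* (y :+ x)) refl _ _ _ _ ⟩
      (n ×ᴿ 1#) * g n * (- g n) ^ d * (- g n + g n)
        ≈⟨ trans (*-congˡ (-‿inverseˡ _)) (zeroʳ _) ⟩
      0#
        ≈⟨ zeroʳ _ ⟨
      (n ×ᴿ 1#) * g n * 0# ∎
    go zero    ≡.refl | no n∤k = contradiction (n Div.∣0) n∤k
    go (suc k) ≡.refl | no n∤k = begin
      T n (n ℕ.+ suc k) + g n * T n (suc k)
        ≈⟨ +-cong (T-∤ n λ n∣ → n∤k (Div.∣m+n∣m⇒∣n n∣ Div.∣-refl)) (trans (*-congˡ (T-∤ n n∤k)) (zeroʳ _)) ⟩
      0# + 0#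
        ≈⟨ trans (+-identityˡ 0#) (sym (zeroʳ _)) ⟩
      (n ×ᴿ 1#) * g n * 0# ∎

  L : ℕ → Series
  L N m = sum N (λ i → T (suc i) m)

  -- With P′ = P + g x^(N+1) P the term (N+1) g x^(N+1) P of D P′ equals T (N+1) · P′ by T-equation.
  D-partialProduct : ∀ N → D (partialProduct N) ≋ L N ⊛ partialProduct N
  D-partialProduct zero zero    = trans (zeroˡ _) (sym (zeroˡ _))
  D-partialProduct zero (suc m) = trans (zeroʳ _) (sym (⊛-zeroˡ one (suc m)))
  D-partialProduct (suc N) m = begin
    D (P ⊕ a · sP) m
      ≈⟨ solve 4 (λ k x a y → k :* (x :+ a :* y) := k :* x :+ a :* (k :* y)) refl _ _ _ _ ⟩
    D P m + a * D sP m
      ≈⟨ +-congˡ (*-congˡ (D-shift n P m)) ⟩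
    D P m + a * (shift n (D P) m + (n ×ᴿ 1#) * sP m)
      ≈⟨ +-cong (D-partialProduct N m) (*-congˡ (+-congʳ (shift-cong n (D-partialProduct N) m))) ⟩
    (L N ⊛ P) m + a * (shift n (L N ⊛ P) m + (n ×ᴿ 1#) * sP m)
      ≈⟨ +-congˡ (*-congˡ (+-congʳ (sym (⊛-shift n (L N) P m)))) ⟩
    (L N ⊛ P) m + a * ((L N ⊛ sP) m + (n ×ᴿ 1#) * sP m)
      ≈⟨ solve 5 (λ x a y k s → x :+ a :* (y :+ k :* s) := (x :+ a :* y) :+ k :* a :* s) refl _ _ _ _ _ ⟩
    (L N ⊛ P) m + a * (L N ⊛ sP) m + (n ×ᴿ 1#) * a * sP m
      ≈⟨ +-cong (sym (trans (⊛-distribˡ (L N) P (a · sP) m) (+-congˡ (⊛-· a (L N) sP m)))) (sym T⊛P′) ⟩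
    (L N ⊛ (P ⊕ a · sP)) m + (T n ⊛ (P ⊕ a · sP)) m
      ≈⟨ ⊛-distribʳ (P ⊕ a · sP) (L N) (T n) m ⟨
    ((L N ⊕ T n) ⊛ (P ⊕ a · sP)) m
      ≈⟨ ⊛-cong {g = P ⊕ a · sP} (λ k → sum-last N (λ i → T (suc i) k)) (λ _ → refl) m ⟨
    (L (suc N) ⊛ (P ⊕ a · sP)) m ∎
    where
    n = suc N
    a = g n
    P = partialProduct N
    sP = shift n P
    T⊛P′ : (T n ⊛ (P ⊕ a · sP)) m ≈ (n ×ᴿ 1#) * a * sP m
    T⊛P′ = begin
      (T n ⊛ (P ⊕ a · sP)) m
        ≈⟨ trans (⊛-distribˡ (T n) P (a · sP) m) (+-congˡ (⊛-· a (T n) sP m)) ⟩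
      (T n ⊛ P) m + a * (T n ⊛ sP) m
        ≈⟨ +-congˡ (*-congˡ (trans (⊛-shift n (T n) P m) (sym (shift-⊛ n (T n) P m)))) ⟩
      (T n ⊛ P) m + a * (shift n (T n) ⊛ P) m
        ≈⟨ +-congˡ (·-⊛ a (shift n (T n)) P m) ⟨
      (T n ⊛ P) m + (a · shift n (T n) ⊛ P) m
        ≈⟨ ⊛-distribʳ P (T n) (a · shift n (T n)) m ⟨
      ((T n ⊕ a · shift n (T n)) ⊛ P) m
        ≈⟨ ⊛-cong {g = P} (T-equation N) (λ _ → refl) m ⟩
      ((n ×ᴿ 1#) * a · shift n one ⊛ P) m
        ≈⟨ ·-⊛ _ (shift n one) P m ⟩
      (n ×ᴿ 1#) * a * (shift n one ⊛ P) m
        ≈⟨ *-congˡ (trans (shift-⊛ n one P m) (shift-cong n (⊛-identityˡ P) m)) ⟩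
      (n ×ᴿ 1#) * a * sP m ∎

  module _ (inv : ℕ → Carrier) (inv-law : ∀ n → (suc n ×ᴿ 1#) * inv (suc n) ≈ 1#) where

    divisorTerm : ℕ → ℕ → Carrier
    divisorTerm n zero            = 0#
    divisorTerm n (suc zero)      = 0#
    divisorTerm n d@(suc (suc _)) = if does (d ∣? n) then (- 1#) ^ d * g (n ℕ./ d) ^ d * inv d else 0#

    divisorTerm-∤ : ∀ {n d} → ¬ (suc (suc d) ∣ n) → divisorTerm n (suc (suc d)) ≡ 0#
    divisorTerm-∤ {n} {d} d∤n = ≡.cong (if_then value else 0#) (dec-false (suc (suc d) ∣? n) d∤n)
      where value = (- 1#) ^ suc (suc d) * g (n ℕ./ suc (suc d)) ^ suc (suc d) * inv (suc (suc d))

    divisorTerm-multiple : ∀ d e → divisorTerm (e ℕ.* suc (suc d)) (suc (suc d)) ≡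
                           (- 1#) ^ suc (suc d) * g e ^ suc (suc d) * inv (suc (suc d))
    divisorTerm-multiple d e = ≡.trans
      (≡.cong (if_then value else 0#) (dec-true (suc (suc d) ∣? e ℕ.* suc (suc d)) (divides e ≡.refl)))
      (≡.cong (λ k → (- 1#) ^ suc (suc d) * g k ^ suc (suc d) * inv (suc (suc d))) (m*n/n≡m e (suc (suc d))))
      where value = (- 1#) ^ suc (suc d) * g (e ℕ.* suc (suc d) ℕ./ suc (suc d)) ^ suc (suc d) * inv (suc (suc d))

    divisorSum : ℕ → Carrier
    divisorSum n = sum (suc n) (divisorTerm n)

    private
      -- The double sum for the logarithmic derivative, grouped by exponent d instead of by factor.
      -- For d ≥ 1 only the factor of index m/d can contribute.
      column : ℕ → ℕ → Carrier
      column m d = sum m (λ i → indicator (suc i) m d)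

      column-∤ : ∀ m d → ¬ (d ∣ m) → column m d ≈ 0#
      column-∤ m d d∤m = sum-zero m λ i _ → reflexive (indicator-≢ (suc i) m d
        λ eq → d∤m (divides (suc i) (≡.trans (≡.sym eq) (ℕₚ.*-comm d (suc i)))))

      column-multiple : ∀ d e → column (suc e ℕ.* suc d) (suc d) ≈ τ (suc e) (suc d)
      column-multiple d e = trans
        (sum-single (suc e ℕ.* suc d) e (λ i → indicator (suc i) (suc e ℕ.* suc d) (suc d)) (ℕₚ.m≤m*n (suc e) (suc d)) λ i i≢e → reflexive (indicator-≢ (suc i) _ (suc d)
          λ eq → i≢e (ℕₚ.suc-injective (ℕₚ.*-cancelʳ-≡ (suc i) (suc e) (suc d) (≡.trans (ℕₚ.*-comm (suc i) (suc d)) eq)))))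
        (reflexive (indicator-≡ (suc e) _ (suc d) (ℕₚ.*-comm (suc d) (suc e))))

      neg-power : ∀ x d → (- x) ^ d ≈ (- 1#) ^ d * x ^ d
      neg-power x d = trans (^-congˡ d (sym (-1*x≈-x x))) (^-distrib-* (- 1#) x d)

      -- If e is the quotient of `suc m` by the exponent, both summands are e times that power of
      -- -g_e, with opposite signs: the exponent contained in `suc m` absorbs the inverse in the
      -- divisor term.
      column+divisorTerm : ∀ m d → column (suc m) (suc (suc d)) + (suc m ×ᴿ 1#) * divisorTerm (suc m) (suc (suc d)) ≈ 0#
      column+divisorTerm m d with suc (suc d) ∣? suc m
      ... | no d∤m = trans (+-cong (column-∤ (suc m) (suc (suc d)) d∤m) (trans (*-congˡ (reflexive (divisorTerm-∤ d∤m))) (zeroʳ _))) (+-identityˡ 0#)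
      ... | yes (divides zero ())
      ... | yes (divides (suc e) ≡.refl) = begin
        column (suc e ℕ.* d″) d″ + ((suc e ℕ.* d″) ×ᴿ 1#) * divisorTerm (suc e ℕ.* d″) d″
          ≈⟨ +-cong (column-multiple (suc d) e) (*-cong (×1-homo-* (suc e) d″) (trans (reflexive (divisorTerm-multiple d (suc e))) (*-congʳ (sym (neg-power x d″))))) ⟩
        k * x * (- x) ^ suc d + k * (d″ ×ᴿ 1#) * ((- x) * (- x) ^ suc d * inv d″)
          ≈⟨ solve 6 (λ k x p d y i → k :* x :* p :+ k :* d :* (y :* p :* i) := k :* p :* (x :+ y :* (d :* i))) refl _ _ _ _ _ _ ⟩
        k * (- x) ^ suc d * (x + - x * ((d″ ×ᴿ 1#) * inv d″))
          ≈⟨ *-congˡ (trans (+-congˡ (trans (*-congˡ (inv-law (suc d))) (*-identityʳ _))) (-‿inverseʳ x)) ⟩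
        k * (- x) ^ suc d * 0#
          ≈⟨ zeroʳ _ ⟩
        0# ∎
        where
        d″ = suc (suc d)
        x = g (suc e)
        k = suc e ×ᴿ 1#

      column-0 : ∀ m → column (suc m) 0 ≈ 0#
      column-0 m = column-∤ (suc m) 0 λ 0∣ → contradiction (Div.0∣⇒≡0 0∣) λ ()

      column-1 : ∀ m → column (suc m) 1 ≈ (suc m ×ᴿ 1#) * g (suc m)
      column-1 m = begin
        column (suc m) 1                 ≡⟨ ≡.cong (λ j → column j 1) (ℕₚ.*-identityʳ (suc m)) ⟨
        column (suc m ℕ.* 1) 1           ≈⟨ column-multiple 0 m ⟩
        (suc m ×ᴿ 1#) * g (suc m) * 1#   ≈⟨ *-identityʳ _ ⟩
        (suc m ×ᴿ 1#) * g (suc m)        ∎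

      -- After the exchange of summations, exponent 0 gives nothing, exponent 1 isolates the newest
      -- coefficient of g, and the exponents from 2 on cancel against the divisor sum.
      L+divisorSum : ∀ m → L (suc m) (suc m) + (suc m ×ᴿ 1#) * divisorSum (suc m) ≈ (suc m ×ᴿ 1#) * g (suc m)
      L+divisorSum m = begin
        L (suc m) (suc m) + k * divisorSum (suc m)
          ≈⟨ +-congʳ (sum-swap (suc m) (suc (suc m)) (λ i → indicator (suc i) (suc m))) ⟩
        column (suc m) 0 + (column (suc m) 1 + sum m (λ d → column (suc m) (suc (suc d))))
          + k * (0# + (0# + sum m (λ d → divisorTerm (suc m) (suc (suc d)))))
          ≈⟨ +-cong (trans (+-congʳ (column-0 m)) (+-identityˡ _))
               (trans (*-congˡ (trans (+-identityˡ _) (+-identityˡ _))) (*-sum m k _)) ⟩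
        column (suc m) 1 + sum m (λ d → column (suc m) (suc (suc d)))
          + sum m (λ d → k * divisorTerm (suc m) (suc (suc d)))
          ≈⟨ trans (+-assoc _ _ _) (+-congˡ (trans (sym (sum-+ m _ _)) (sum-zero m λ d _ → column+divisorTerm m d))) ⟩
        column (suc m) 1 + 0#
          ≈⟨ trans (+-identityʳ _) (column-1 m) ⟩
        k * g (suc m) ∎
        where k = suc m ×ᴿ 1#

    -- Up to order n, f may be replaced by its n-th partial product P, for which D P = L P.
    -- Cancelling f identifies Cₙ with the n-th coefficient of L n, and dividing by n gives the
    -- recurrence.
    power-product-recurrence : ∀ (f C c : Series) → f 0 ≈ 1# → D f ≋ C ⊛ f →
      (∀ n → (suc n ×ᴿ 1#) * c (suc n) ≈ C (suc n)) →
      (∀ N m → m ≤ N → partialProduct N m ≈ f m) →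
      ∀ n → g (suc n) ≈ divisorSum (suc n) + c (suc n)
    power-product-recurrence f C c f₀ Df C≈ f-product m = begin
      g n                                    ≈⟨ cancel (g n) ⟨
      inv n * (k * g n)                      ≈⟨ *-congˡ (L+divisorSum m) ⟨
      inv n * (L n n + k * divisorSum n)     ≈⟨ *-congˡ (+-congʳ (trans (sym C≈L) (sym (C≈ m)))) ⟩
      inv n * (k * c n + k * divisorSum n)
        ≈⟨ solve 4 (λ i k c d → i :* (k :* c :+ k :* d) := i :* (k :* (d :+ c))) refl _ _ _ _ ⟩
      inv n * (k * (divisorSum n + c n))     ≈⟨ cancel _ ⟩
      divisorSum n + c n                     ∎
      where
      n = suc m
      k = n ×ᴿ 1#
      cancel : ∀ x → inv n * (k * x) ≈ x
      cancel x = trans (trans (sym (*-assoc _ _ _)) (*-congʳ (trans (*-comm _ _) (inv-law m)))) (*-identityˡ x)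
      C≈L : C n ≈ L n n
      C≈L = ⊛-cancelʳ f f₀ n C (L n) λ i i≤n → begin
        (C ⊛ f) i                     ≈⟨ Df i ⟨
        (i ×ᴿ 1#) * f i               ≈⟨ *-congˡ (f-product n i i≤n) ⟨
        D (partialProduct n) i        ≈⟨ D-partialProduct n i ⟩
        (L n ⊛ partialProduct n) i    ≈⟨ ⊛-cong-≤ i {L n} (λ _ _ → refl) (λ j j≤i → f-product n j (ℕₚ.≤-trans j≤i i≤n)) ⟩
        (L n ⊛ f) i                   ∎

-- Parity of divisors

even-or-suc-even : ∀ n → 2 ∣ n ⊎ 2 ∣ suc n
even-or-suc-even zero = inj₁ (2 Div.∣0)
even-or-suc-even (suc n) with even-or-suc-even n
... | inj₁ 2∣n   = inj₂ (Div.∣m∣n⇒∣m+n Div.∣-refl 2∣n)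
... | inj₂ 2∣1+n = inj₁ 2∣1+n

-- Odd numbers appear as successors of even ones. An even `suc e` would make `suc n` even together
-- with n, so 2 would divide 1.
odd-divisor : ∀ {n e d} → 2 ∣ n → suc n ≡ suc e ℕ.* d → 2 ∣ e
odd-divisor {n} {e} {d} 2∣n eq with even-or-suc-even e
... | inj₁ 2∣e   = 2∣e
... | inj₂ 2∣1+e with Div.∣1⇒≡1 (Div.∣m+n∣m⇒∣n (≡.subst (2 ∣_) (ℕₚ.+-comm 1 n) 2∣1+n) 2∣n)
  where
  2∣1+n : 2 ∣ suc n
  2∣1+n = ≡.subst (2 ∣_) (≡.sym eq) (Div.∣m⇒∣m*n d 2∣1+e)
...   | ()

-- Divisor recurrences: uniqueness at odd indices and behaviour under ring endomorphisms

module Recurrences {c ℓ} (R : CommutativeRing c ℓ) where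
  open CommutativeRing R
  open SemiringMult semiring using () renaming (_×_ to _×ᴿ_)

  module WithInverses (inv : ℕ → Carrier) (inv-law : ∀ n → (suc n ×ᴿ 1#) * inv (suc n) ≈ 1#) where
    open SemiringExp commutativeSemiring using (_^_; ^-congˡ)
    open SetoidReasoning setoid
    open PowerProducts R hiding (divisorTerm; divisorSum)
    open Sums R

    divisorTerm : (ℕ → Carrier) → ℕ → ℕ → Carrier
    divisorTerm g = PowerProducts.divisorTerm R g inv inv-law

    divisorSum : (ℕ → Carrier) → ℕ → Carrier
    divisorSum g = PowerProducts.divisorSum R g inv inv-law

    divisorTerm-cong : ∀ g h n d → (∀ e → suc n ≡ suc e ℕ.* suc (suc d) → g (suc e) ≈ h (suc e)) →
                       divisorTerm g (suc n) (suc (suc d)) ≈ divisorTerm h (suc n) (suc (suc d))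
    divisorTerm-cong g h n d p with suc (suc d) ∣? suc n
    ... | no d∤n = reflexive (≡.trans (divisorTerm-∤ g inv inv-law d∤n) (≡.sym (divisorTerm-∤ h inv inv-law d∤n)))
    ... | yes (divides zero ())
    ... | yes (divides (suc e) ≡.refl) = begin
      divisorTerm g (suc e ℕ.* d″) d″         ≡⟨ divisorTerm-multiple g inv inv-law d (suc e) ⟩
      (- 1#) ^ d″ * g (suc e) ^ d″ * inv d″   ≈⟨ *-congʳ (*-congˡ (^-congˡ d″ (p e ≡.refl))) ⟩
      (- 1#) ^ d″ * h (suc e) ^ d″ * inv d″   ≡⟨ divisorTerm-multiple h inv inv-law d (suc e) ⟨
      divisorTerm h (suc e ℕ.* d″) d″         ∎
      where d″ = suc (suc d)

    -- Agreement is asked only at the divisors that occur, namely those with cofactor at least 2;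
    -- this is exactly what strong induction can supply.
    divisorSum-cong : ∀ g h n → (∀ d e → suc n ≡ suc e ℕ.* suc (suc d) → g (suc e) ≈ h (suc e)) →
                      divisorSum g (suc n) ≈ divisorSum h (suc n)
    divisorSum-cong g h n p =
      +-congˡ (+-congˡ (sum-cong n λ d _ → divisorTerm-cong g h n d (p d)))

    -- Divisors of odd numbers are odd, so the recurrence at odd indices only involves odd indices.
    odd-unique : ∀ (g h c c′ : ℕ → Carrier) →
      (∀ n → g (suc n) ≈ divisorSum g (suc n) + c (suc n)) →
      (∀ n → h (suc n) ≈ divisorSum h (suc n) + c′ (suc n)) →
      (∀ n → 2 ∣ n → c (suc n) ≈ c′ (suc n)) →
      ∀ n → 2 ∣ n → g (suc n) ≈ h (suc n)
    odd-unique g h c c′ g-rec h-rec c≈c′ = <-rec (λ n → 2 ∣ n → g (suc n) ≈ h (suc n)) λ n rec 2∣n → begin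
      g (suc n)                           ≈⟨ g-rec n ⟩
      divisorSum g (suc n) + c (suc n)
        ≈⟨ +-cong (divisorSum-cong g h n λ d e eq → rec (e<n d e eq) (odd-divisor 2∣n eq)) (c≈c′ n 2∣n) ⟩
      divisorSum h (suc n) + c′ (suc n)   ≈⟨ h-rec n ⟨
      h (suc n)                           ∎
      where
      -- The cofactor is at least 2, so the divisor is proper.
      e<n : ∀ {n} d e → suc n ≡ suc e ℕ.* suc (suc d) → e < n
      e<n {n} d e eq = ℕₚ.≤-pred (≡.subst (suc e <_) (≡.sym eq) (ℕₚ.m<m*n (suc e) (suc (suc d)) (s≤s (s≤s z≤n))))

    open RingMorphisms rawRing rawRing using (IsRingHomomorphism)

    module _ {φ : Carrier → Carrier} (φ-hom : IsRingHomomorphism φ) where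
      open IsRingHomomorphism φ-hom

      ^-homo : ∀ x n → φ (x ^ n) ≈ φ x ^ n
      ^-homo x zero    = 1#-homo
      ^-homo x (suc n) = trans (*-homo x (x ^ n)) (*-congˡ (^-homo x n))

      ×1-homo : ∀ n → φ (n ×ᴿ 1#) ≈ n ×ᴿ 1#
      ×1-homo zero    = 0#-homo
      ×1-homo (suc n) = trans (+-homo 1# (n ×ᴿ 1#)) (+-cong 1#-homo (×1-homo n))

      sum-homo : ∀ n f → φ (sum n f) ≈ sum n (φ ∘ f)
      sum-homo zero    f = 0#-homo
      sum-homo (suc n) f = trans (+-homo _ _) (+-congˡ (sum-homo n (f ∘ suc)))

      -- A ring homomorphism fixes the multiples of 1, and inverses are unique.
      inv-homo : ∀ n → φ (inv (suc n)) ≈ inv (suc n)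
      inv-homo n = begin
        φ i              ≈⟨ *-identityʳ _ ⟨
        φ i * 1#         ≈⟨ *-congˡ (inv-law n) ⟨
        φ i * (k * i)    ≈⟨ *-assoc _ _ _ ⟨
        φ i * k * i      ≈⟨ *-congʳ (begin
          φ i * k        ≈⟨ *-comm _ _ ⟩
          k * φ i        ≈⟨ *-congʳ (×1-homo (suc n)) ⟨
          φ k * φ i      ≈⟨ *-homo k i ⟨
          φ (k * i)      ≈⟨ ⟦⟧-cong (inv-law n) ⟩
          φ 1#           ≈⟨ 1#-homo ⟩
          1#             ∎) ⟩
        1# * i           ≈⟨ *-identityˡ _ ⟩
        i                ∎
        where
        i = inv (suc n)
        k = suc n ×ᴿ 1#

      divisorTerm-homo : ∀ g n d → φ (divisorTerm g (suc n) (suc (suc d))) ≈ divisorTerm (φ ∘ g) (suc n) (suc (suc d))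
      divisorTerm-homo g n d with suc (suc d) ∣? suc n
      ... | no d∤n = begin
        φ (divisorTerm g (suc n) (suc (suc d)))     ≡⟨ ≡.cong φ (divisorTerm-∤ g inv inv-law d∤n) ⟩
        φ 0#                                        ≈⟨ 0#-homo ⟩
        0#                                          ≡⟨ divisorTerm-∤ (φ ∘ g) inv inv-law d∤n ⟨
        divisorTerm (φ ∘ g) (suc n) (suc (suc d))   ∎
      ... | yes (divides zero ())
      ... | yes (divides (suc e) ≡.refl) = begin
        φ (divisorTerm g (suc e ℕ.* d″) d″)                 ≡⟨ ≡.cong φ (divisorTerm-multiple g inv inv-law d (suc e)) ⟩
        φ ((- 1#) ^ d″ * g (suc e) ^ d″ * inv d″)           ≈⟨ *-homo _ _ ⟩
        φ ((- 1#) ^ d″ * g (suc e) ^ d″) * φ (inv d″)       ≈⟨ *-cong (*-homo _ _) (inv-homo (suc d)) ⟩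
        φ ((- 1#) ^ d″) * φ (g (suc e) ^ d″) * inv d″
          ≈⟨ *-congʳ (*-cong (trans (^-homo (- 1#) d″) (^-congˡ d″ (trans (-‿homo 1#) (-‿cong 1#-homo)))) (^-homo (g (suc e)) d″)) ⟩
        (- 1#) ^ d″ * φ (g (suc e)) ^ d″ * inv d″           ≡⟨ divisorTerm-multiple (φ ∘ g) inv inv-law d (suc e) ⟨
        divisorTerm (φ ∘ g) (suc e ℕ.* d″) d″               ∎
        where d″ = suc (suc d)

      -- The divisor sum has rational coefficients, which φ fixes; only the inhomogeneous term
      -- changes.
      recurrence-homo : ∀ (g c : ℕ → Carrier) →
        (∀ n → g (suc n) ≈ divisorSum g (suc n) + c (suc n)) →
        ∀ n → φ (g (suc n)) ≈ divisorSum (φ ∘ g) (suc n) + φ (c (suc n))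
      recurrence-homo g c g-rec n = begin
        φ (g (suc n))                                      ≈⟨ ⟦⟧-cong (g-rec n) ⟩
        φ (divisorSum g (suc n) + c (suc n))               ≈⟨ +-homo _ _ ⟩
        φ (divisorSum g (suc n)) + φ (c (suc n))           ≈⟨ +-congʳ (begin
          φ (0# + (0# + sum n _))   ≈⟨ trans (+-homo _ _) (+-cong 0#-homo (trans (+-homo _ _) (+-cong 0#-homo (sum-homo n _)))) ⟩
          0# + (0# + sum n _)       ≈⟨ +-congˡ (+-congˡ (sum-cong n λ d _ → divisorTerm-homo g n d)) ⟩
          0# + (0# + sum n _)       ∎) ⟩
        divisorSum (φ ∘ g) (suc n) + φ (c (suc n))         ∎

-- Units of a commutative ring

module Units {c ℓ} (R : CommutativeRing c ℓ) where
  open CommutativeRing R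
  open SetoidReasoning setoid
  open NaturalSolver commutativeSemiring using (solve; _:=_; _:*_)
  open SemiringExp commutativeSemiring using (_^_)

  record IsUnit (x : Carrier) : Set (c Level.⊔ ℓ) where
    field
      inverse : Carrier
      law     : x * inverse ≈ 1#
  open IsUnit

  unit-cancel : ∀ {z} → IsUnit z → ∀ {x y} → z * x ≈ z * y → x ≈ y
  unit-cancel {z} u {x} {y} eq = begin
    x                      ≈⟨ *-identityˡ _ ⟨
    1# * x                 ≈⟨ *-congʳ (trans (*-comm _ _) (law u)) ⟨
    inverse u * z * x      ≈⟨ *-assoc _ _ _ ⟩
    inverse u * (z * x)    ≈⟨ *-congˡ eq ⟩
    inverse u * (z * y)    ≈⟨ *-assoc _ _ _ ⟨
    inverse u * z * y      ≈⟨ *-congʳ (trans (*-comm _ _) (law u)) ⟩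
    1# * y                 ≈⟨ *-identityˡ _ ⟩
    y                      ∎

  unit-* : ∀ {x y} → IsUnit x → IsUnit y → IsUnit (x * y)
  unit-* {x} {y} u v = record
    { inverse = inverse u * inverse v
    ; law = trans (solve 4 (λ x y a b → x :* y :* (a :* b) := x :* a :* (y :* b)) refl x y (inverse u) (inverse v))
              (trans (*-cong (law u) (law v)) (*-identityˡ 1#)) }

  unit-^ : ∀ {x} → IsUnit x → ∀ n → IsUnit (x ^ n)
  unit-^ u zero    = record { inverse = 1# ; law = *-identityˡ 1# }
  unit-^ u (suc n) = unit-* u (unit-^ u n)

  unit-factor : ∀ {x y z} → x * y ≈ z → IsUnit z → IsUnit y
  unit-factor {x} {y} {z} eq u = record
    { inverse = x * inverse u
    ; law = trans (solve 3 (λ x y a → y :* (x :* a) := x :* y :* a) refl x y (inverse u))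
              (trans (*-congʳ eq) (law u)) }

-- The expansions of the q-exponentials over an abstract ring

module QExponentials {c ℓ} (R : CommutativeRing c ℓ) where
  open CommutativeRing R
  open SemiringMult semiring using () renaming (_×_ to _×ᴿ_)
  open SemiringExp commutativeSemiring using (_^_; ^-distrib-*; ^-congˡ; ^-assocʳ)
  open Units R
  open PowerSeries R
  open QAnalogs R using ([_])

  -- The series f, F and h stand for exp_t, Exp_t and exp_s with s = 1/t; each is given by its
  -- constant term and its first-order recurrence.
  module Expansions
    (inv : ℕ → Carrier) (inv-law : ∀ n → (suc n ×ᴿ 1#) * inv (suc n) ≈ 1#)
    (t s : Carrier) (ts≈1 : t * s ≈ 1#)
    ([]-unit : ∀ n → IsUnit ([ t ] (suc n)))
    (f F h : Series)
    (f₀ : f 0 ≈ 1#) (f-suc : ∀ n → [ t ] (suc n) * f (suc n) ≈ f n)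
    (F₀ : F 0 ≈ 1#) (F-suc : ∀ n → [ t ] (suc n) * F (suc n) ≈ t ^ n * F n)
    (h₀ : h 0 ≈ 1#) (h-suc : ∀ n → [ s ] (suc n) * h (suc n) ≈ h n)
    where
    open SetoidReasoning setoid
    open NaturalSolver commutativeSemiring using (solve; _:=_; _:+_; _:*_)
    open RingProperties ring using (+-cancelʳ)
    open Sums R
    open PowerProducts R using (partialProduct; power-product-recurrence)
    open Recurrences.WithInverses R inv inv-law
    open RingMorphisms rawRing rawRing using (IsRingHomomorphism)

    -- The factor tⁿ reverses the order of the summands: sⁱ becomes tⁿ⁻ⁱ.
    reciprocal-bracket : ∀ n → t ^ n * [ s ] (suc n) ≈ [ t ] (suc n)
    reciprocal-bracket zero    = *-identityˡ _
    reciprocal-bracket (suc n) = begin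
      t * t ^ n * (1# + sum (suc n) (λ i → s * s ^ i))
        ≈⟨ *-congˡ (+-congˡ (*-sum (suc n) s (s ^_))) ⟨
      t * t ^ n * (1# + s * [ s ] (suc n))
        ≈⟨ distribˡ _ _ _ ⟩
      t * t ^ n * 1# + t * t ^ n * (s * [ s ] (suc n))
        ≈⟨ +-cong (*-identityʳ _) (solve 4 (λ t p s b → t :* p :* (s :* b) := t :* s :* (p :* b)) refl _ _ _ _) ⟩
      t * t ^ n + t * s * (t ^ n * [ s ] (suc n))
        ≈⟨ +-congˡ (trans (*-cong ts≈1 (reciprocal-bracket n)) (*-identityˡ _)) ⟩
      t ^ suc n + [ t ] (suc n)
        ≈⟨ +-comm _ _ ⟩
      [ t ] (suc n) + t ^ suc n
        ≈⟨ sum-last (suc n) (t ^_) ⟨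
      [ t ] (suc (suc n)) ∎

    t-unit : IsUnit t
    t-unit = record { inverse = s ; law = ts≈1 }

    []-unit′ : ∀ n → IsUnit ([ s ] (suc n))
    []-unit′ n = unit-factor (reciprocal-bracket n) ([]-unit n)

    -- The factor tⁿ in the recurrence of F is exactly what turns [n+1] at s into [n+1] at t, so
    -- both series satisfy the same recurrence.
    F≋h : F ≋ h
    F≋h zero    = trans F₀ (sym h₀)
    F≋h (suc n) = unit-cancel ([]-unit n) (begin
      [ t ] (suc n) * F (suc n)              ≈⟨ F-suc n ⟩
      t ^ n * F n                            ≈⟨ *-congˡ (F≋h n) ⟩
      t ^ n * h n                            ≈⟨ *-congˡ (h-suc n) ⟨
      t ^ n * ([ s ] (suc n) * h (suc n))    ≈⟨ *-assoc _ _ _ ⟨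
      t ^ n * [ s ] (suc n) * h (suc n)      ≈⟨ *-congʳ (reciprocal-bracket n) ⟩
      [ t ] (suc n) * h (suc n)              ∎)

    F⊛f₋≋one : F ⊛ (λ n → (- 1#) ^ n * f n) ≋ one
    F⊛f₋≋one = QAnalogs.Exp-inverse R t (λ n → unit-cancel ([]-unit n)) F (λ n → (- 1#) ^ n * f n)
      (trans (*-cong F₀ (trans (*-identityˡ _) f₀)) (*-identityˡ _)) F-suc λ n → begin
        [ t ] (suc n) * (- 1# * (- 1#) ^ n * f (suc n))
          ≈⟨ solve 4 (λ b m p x → b :* (m :* p :* x) := m :* (p :* (b :* x))) refl _ _ _ _ ⟩
        - 1# * ((- 1#) ^ n * ([ t ] (suc n) * f (suc n)))
          ≈⟨ *-congˡ (*-congˡ (f-suc n)) ⟩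
        - 1# * ((- 1#) ^ n * f n) ∎

    -- The formula cₙ = wⁿ⁻¹/(n[n]) with its denominator cleared; w is 1 - t for f and t - 1 for F.
    IsQuotient : Carrier → Series → Set ℓ
    IsQuotient w c = ∀ n → c (suc n) * ((suc n ×ᴿ 1#) * [ t ] (suc n)) ≈ w ^ n

    quotient-unique : ∀ w w′ n {x y} → w ^ n ≈ w′ ^ n →
      x * ((suc n ×ᴿ 1#) * [ t ] (suc n)) ≈ w ^ n → y * ((suc n ×ᴿ 1#) * [ t ] (suc n)) ≈ w′ ^ n → x ≈ y
    quotient-unique w w′ n w≈w′ p r =
      unit-cancel (unit-* (record { inverse = inv (suc n) ; law = inv-law n }) ([]-unit n))
        (trans (*-comm _ _) (trans p (trans w≈w′ (trans (sym r) (*-comm _ _)))))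

    log-coefficient : Series → Series
    log-coefficient c n = (n ×ᴿ 1#) * c n

    module _ (g : ℕ → Carrier) (c : Series) where

      exp-recurrence : ∀ u → u + t ≈ 1# → IsQuotient u c →
        (∀ N m → m ≤ N → partialProduct g N m ≈ f m) →
        ∀ n → g (suc n) ≈ divisorSum g (suc n) + c (suc n)
      exp-recurrence u u+t c-quot = power-product-recurrence g inv inv-law f (log-coefficient c) c f₀
        (QAnalogs.exp-log-derivative R t (λ n → unit-cancel ([]-unit n)) u u+t f (log-coefficient c) f-suc (zeroˡ _) λ n →
          trans (solve 3 (λ b k c → b :* (k :* c) := c :* (k :* b)) refl _ _ _) (c-quot n))
        (λ _ → refl)

      -- Exp_q = exp_{1/q}, so its logarithmic derivative has coefficients (1-1/q)ⁿ⁻¹/[n]_{1/q} = (q-1)ⁿ⁻¹/[n].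
      Exp-recurrence : ∀ v → v + 1# ≈ t → IsQuotient v c →
        (∀ N m → m ≤ N → partialProduct g N m ≈ F m) →
        ∀ n → g (suc n) ≈ divisorSum g (suc n) + c (suc n)
      Exp-recurrence v v+1 c-quot F-product = power-product-recurrence g inv inv-law h (log-coefficient c) c h₀
        (QAnalogs.exp-log-derivative R s (λ n → unit-cancel ([]-unit′ n)) (v * s) vs+s h (log-coefficient c) h-suc (zeroˡ _) C-suc)
        (λ _ → refl) (λ N m m≤N → trans (F-product N m m≤N) (F≋h m))
        where
        vs+s : v * s + s ≈ 1#
        vs+s = begin
          v * s + s        ≈⟨ +-congˡ (*-identityˡ s) ⟨
          v * s + 1# * s   ≈⟨ distribʳ s v 1# ⟨
          (v + 1#) * s     ≈⟨ *-congʳ v+1 ⟩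
          t * s            ≈⟨ ts≈1 ⟩
          1#               ∎
        C-suc : ∀ n → [ s ] (suc n) * ((suc n ×ᴿ 1#) * c (suc n)) ≈ (v * s) ^ n
        -- Multiplying by tⁿ turns the bracket at s into the bracket at t and (v s)ⁿ into vⁿ.
        C-suc n = unit-cancel (unit-^ t-unit n) (begin
          t ^ n * ([ s ] (suc n) * ((suc n ×ᴿ 1#) * c (suc n)))
            ≈⟨ solve 4 (λ p b k c → p :* (b :* (k :* c)) := c :* (k :* (p :* b))) refl _ _ _ _ ⟩
          c (suc n) * ((suc n ×ᴿ 1#) * (t ^ n * [ s ] (suc n)))
            ≈⟨ *-congˡ (*-congˡ (reciprocal-bracket n)) ⟩
          c (suc n) * ((suc n ×ᴿ 1#) * [ t ] (suc n))
            ≈⟨ c-quot n ⟩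
          v ^ n
            ≈⟨ ^-congˡ n (trans (*-congˡ ts≈1) (*-identityʳ v)) ⟨
          (v * (t * s)) ^ n
            ≈⟨ ^-congˡ n (solve 3 (λ v t s → v :* (t :* s) := t :* (v :* s)) refl v t s) ⟩
          (t * (v * s)) ^ n
            ≈⟨ ^-distrib-* t (v * s) n ⟩
          t ^ n * (v * s) ^ n ∎)

    even-power : ∀ x y → x + y ≈ 0# → ∀ n → 2 ∣ n → x ^ n ≈ y ^ n
    even-power x y x+y≈0 n (divides k ≡.refl) = begin
      x ^ (k ℕ.* 2)   ≡⟨ ≡.cong (x ^_) (ℕₚ.*-comm k 2) ⟩
      x ^ (2 ℕ.* k)   ≈⟨ ^-assocʳ x 2 k ⟨
      (x ^ 2) ^ k     ≈⟨ ^-congˡ k x²≈y² ⟩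
      (y ^ 2) ^ k     ≈⟨ ^-assocʳ y 2 k ⟩
      y ^ (2 ℕ.* k)   ≡⟨ ≡.cong (y ^_) (ℕₚ.*-comm k 2) ⟨
      y ^ (k ℕ.* 2)   ∎
      where
      x²≈y² : x ^ 2 ≈ y ^ 2
      -- Adding xy makes both squares multiples of x + y: x² + xy = x(x + y) and y² + xy = (y + x)y.
      x²≈y² = +-cancelʳ (x * y) _ _ (begin
        x * (x * 1#) + x * y   ≈⟨ +-congʳ (*-congˡ (*-identityʳ x)) ⟩
        x * x + x * y          ≈⟨ trans (sym (distribˡ x x y)) (trans (*-congˡ x+y≈0) (zeroʳ x)) ⟩
        0#                     ≈⟨ trans (sym (distribʳ y y x)) (trans (*-congʳ (trans (+-comm y x) x+y≈0)) (zeroˡ y)) ⟨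
        y * y + x * y          ≈⟨ +-congʳ (*-congˡ (*-identityʳ y)) ⟨
        y * (y * 1#) + x * y   ∎)

    module OddCoefficients (u v : Carrier) (u+t : u + t ≈ 1#) (v+1 : v + 1# ≈ t)
      (cₑ cᴱ : Series) (cₑ-quot : IsQuotient u cₑ) (cᴱ-quot : IsQuotient v cᴱ)
      (e E : ℕ → Carrier)
      (e-rec : ∀ n → e (suc n) ≈ divisorSum e (suc n) + cₑ (suc n))
      (E-rec : ∀ n → E (suc n) ≈ divisorSum E (suc n) + cᴱ (suc n)) where

      odd-e≈E : ∀ n → 2 ∣ n → e (suc n) ≈ E (suc n)
      odd-e≈E = odd-unique e E cₑ cᴱ e-rec E-rec λ n 2∣n →
        quotient-unique u v n (even-power u v u+v≈0 n 2∣n) (cₑ-quot n) (cᴱ-quot n)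
        where
        u+v≈0 : u + v ≈ 0#
        u+v≈0 = +-cancelʳ 1# _ _ (begin
          u + v + 1#     ≈⟨ +-assoc u v 1# ⟩
          u + (v + 1#)   ≈⟨ +-congˡ v+1 ⟩
          u + t          ≈⟨ u+t ⟩
          1#             ≈⟨ +-identityˡ 1# ⟨
          0# + 1#        ∎)

      -- The comparison runs through E: since t·φ(u) = t - 1, φ carries the inhomogeneous term of
      -- the recurrence for e to that of the recurrence for E.
      odd-e≈φe : ∀ {φ} → IsRingHomomorphism φ → φ t ≈ s → ∀ n → 2 ∣ n → e (suc n) ≈ φ (e (suc n))
      odd-e≈φe {φ} φ-hom φt n 2∣n = trans (odd-e≈E n 2∣n) (sym (odd-unique (φ ∘ e) E (φ ∘ cₑ) cᴱ
        (recurrence-homo φ-hom e cₑ e-rec) E-rec (λ k _ → quotient-unique v v k refl (φcₑ-quot k) (cᴱ-quot k)) n 2∣n))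
        where
        open IsRingHomomorphism φ-hom using (+-homo; *-homo; ⟦⟧-cong; 1#-homo)
        φ-bracket : ∀ k → φ ([ t ] k) ≈ [ s ] k
        φ-bracket k = trans (sum-homo φ-hom k (t ^_)) (sum-cong k λ i _ → trans (^-homo φ-hom t i) (^-congˡ i φt))
        tφu≈v : t * φ u ≈ v
        tφu≈v = +-cancelʳ 1# _ _ (begin
          t * φ u + 1#      ≈⟨ +-congˡ ts≈1 ⟨
          t * φ u + t * s   ≈⟨ distribˡ t (φ u) s ⟨
          t * (φ u + s)     ≈⟨ *-congˡ (trans (+-congˡ (sym φt)) (trans (sym (+-homo u t)) (trans (⟦⟧-cong u+t) 1#-homo))) ⟩
          t * 1#            ≈⟨ trans (*-identityʳ t) (sym v+1) ⟩
          v + 1#            ∎)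
        φcₑ-quot : IsQuotient v (φ ∘ cₑ)
        φcₑ-quot k = begin
          φ (cₑ (suc k)) * ((suc k ×ᴿ 1#) * [ t ] (suc k))
            ≈⟨ *-congˡ (*-congˡ (reciprocal-bracket k)) ⟨
          φ (cₑ (suc k)) * ((suc k ×ᴿ 1#) * (t ^ k * [ s ] (suc k)))
            ≈⟨ solve 4 (λ c n p b → c :* (n :* (p :* b)) := p :* (c :* (n :* b))) refl _ _ _ _ ⟩
          t ^ k * (φ (cₑ (suc k)) * ((suc k ×ᴿ 1#) * [ s ] (suc k)))
            ≈⟨ *-congˡ (*-congˡ (*-cong (×1-homo φ-hom (suc k)) (φ-bracket (suc k)))) ⟨
          t ^ k * (φ (cₑ (suc k)) * (φ (suc k ×ᴿ 1#) * φ ([ t ] (suc k))))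
            ≈⟨ *-congˡ (trans (*-homo _ _) (*-congˡ (*-homo _ _))) ⟨
          t ^ k * φ (cₑ (suc k) * ((suc k ×ᴿ 1#) * [ t ] (suc k)))
            ≈⟨ *-congˡ (trans (⟦⟧-cong (cₑ-quot k)) (^-homo φ-hom u k)) ⟩
          t ^ k * φ u ^ k
            ≈⟨ ^-distrib-* t (φ u) k ⟨
          (t * φ u) ^ k
            ≈⟨ ^-congˡ k tφu≈v ⟩
          v ^ k ∎

-- Arithmetic of quotients x = α/β given as relations x·β = α

module Quotients {c ℓ} (R : CommutativeRing c ℓ) where
  open CommutativeRing R renaming (_+_ to _⊹_; _*_ to _∙_)
  open SetoidReasoning setoid
  open NaturalSolver commutativeSemiring using (solve; _:=_; _:+_; _:*_)

  quotient-+ : ∀ {x y α β γ δ} → x ∙ β ≈ α → y ∙ δ ≈ γ → β ∙ δ ∙ (x ⊹ y) ≈ α ∙ δ ⊹ γ ∙ β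
  quotient-+ {x} {y} {α} {β} {γ} {δ} p r = trans
    (solve 4 (λ x y b d → b :* d :* (x :+ y) := x :* b :* d :+ y :* d :* b) refl x y β δ)
    (+-cong (*-congʳ p) (*-congʳ r))

  quotient-* : ∀ {x y α β γ δ} → x ∙ β ≈ α → y ∙ δ ≈ γ → β ∙ δ ∙ (x ∙ y) ≈ α ∙ γ
  quotient-* {x} {y} {α} {β} {γ} {δ} p r = trans
    (solve 4 (λ x y b d → b :* d :* (x :* y) := x :* b :* (y :* d)) refl x y β δ) (*-cong p r)

  quotient-cong : ∀ {x y α β γ δ} → x ∙ β ≈ α → y ∙ δ ≈ γ → α ∙ δ ≈ γ ∙ β → β ∙ δ ∙ x ≈ β ∙ δ ∙ y
  quotient-cong {x} {y} {α} {β} {γ} {δ} p r eq = begin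
    β ∙ δ ∙ x     ≈⟨ solve 3 (λ x b d → b :* d :* x := x :* b :* d) refl x β δ ⟩
    x ∙ β ∙ δ     ≈⟨ *-congʳ p ⟩
    α ∙ δ         ≈⟨ eq ⟩
    γ ∙ β         ≈⟨ *-congʳ r ⟨
    y ∙ δ ∙ β     ≈⟨ solve 3 (λ y b d → y :* d :* b := b :* d :* y) refl y β δ ⟩
    β ∙ δ ∙ y     ∎

module ConvolutionSum {c ℓ} (R : CommutativeRing c ℓ) where
  open CommutativeRing R renaming (_+_ to _⊹_; _*_ to _∙_)
  open PowerSeries R
  open Sums R

  -- Links the recursive convolution to the indexed sum by which `_⋆_` is defined.
  ⊛-sum : ∀ f g n → sum (suc n) (λ k → f k ∙ g (n ∸ k)) ≈ (f ⊛ g) n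
  ⊛-sum f g zero    = +-identityʳ _
  ⊛-sum f g (suc n) = +-congˡ (⊛-sum (f ∘ suc) g n)

-- The field laws of ℚ(q) as cross-multiplied semiring identities.
module FractionIdentities {c ℓ} (S : CommutativeSemiring c ℓ) where
  open CommutativeSemiring S
  open NaturalSolver S using (solve; _:=_; _:+_; _:*_)

  +-assoc-fraction : ∀ a b c d e f →
    ((a * d + c * b) * f + e * (b * d)) * (b * (d * f)) ≈ (a * (d * f) + (c * f + e * d) * b) * ((b * d) * f)
  +-assoc-fraction = solve 6 (λ a b c d e f →
    ((a :* d :+ c :* b) :* f :+ e :* (b :* d)) :* (b :* (d :* f)) := (a :* (d :* f) :+ (c :* f :+ e :* d) :* b) :* ((b :* d) :* f)) refl

  +-comm-fraction : ∀ a b c d → (a * d + c * b) * (d * b) ≈ (c * b + a * d) * (b * d)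
  +-comm-fraction = solve 4 (λ a b c d → (a :* d :+ c :* b) :* (d :* b) := (c :* b :+ a :* d) :* (b :* d)) refl

  distribʳ-fraction : ∀ a b c d e f →
    ((c * f + e * d) * a) * ((d * b) * (f * b)) ≈ ((c * a) * (f * b) + (e * a) * (d * b)) * ((d * f) * b)
  distribʳ-fraction = solve 6 (λ a b c d e f →
    ((c :* f :+ e :* d) :* a) :* ((d :* b) :* (f :* b)) := ((c :* a) :* (f :* b) :+ (e :* a) :* (d :* b)) :* ((d :* f) :* b)) refl

  +-cong-fraction : ∀ {a b a′ b′ c d c′ d′} → a * b′ ≈ a′ * b → c * d′ ≈ c′ * d →
    (a * d + c * b) * (b′ * d′) ≈ (a′ * d′ + c′ * b′) * (b * d)
  +-cong-fraction {a} {b} {a′} {b′} {c} {d} {c′} {d′} p r = trans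
    (solve 6 (λ a b c d b′ d′ → (a :* d :+ c :* b) :* (b′ :* d′) := (a :* b′) :* (d :* d′) :+ (c :* d′) :* (b :* b′)) refl a b c d b′ d′)
    (trans (+-cong (*-congʳ p) (*-congʳ r))
    (solve 6 (λ a′ b c′ d b′ d′ → (a′ :* b) :* (d :* d′) :+ (c′ :* d) :* (b :* b′) := (a′ :* d′ :+ c′ :* b′) :* (b :* d)) refl a′ b c′ d b′ d′))

  *-cong-fraction : ∀ {a b a′ b′ c d c′ d′} → a * b′ ≈ a′ * b → c * d′ ≈ c′ * d →
    (a * c) * (b′ * d′) ≈ (a′ * c′) * (b * d)
  *-cong-fraction {a} {b} {a′} {b′} {c} {d} {c′} {d′} p r = trans
    (solve 4 (λ a b c d → (a :* c) :* (b :* d) := (a :* b) :* (c :* d)) refl a b′ c d′)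
    (trans (*-cong p r) (solve 4 (λ a b c d → (a :* b) :* (c :* d) := (a :* c) :* (b :* d)) refl a′ b c′ d))

  -- The middle denominator d remains as a common factor; removing it requires that d be nonzero.
  trans-fraction : ∀ a b c d e f → a * d ≈ c * b → c * f ≈ e * d → (a * f) * d ≈ (e * b) * d
  trans-fraction a b c d e f p r = trans
    (solve 3 (λ a f d → (a :* f) :* d := (a :* d) :* f) refl a f d)
    (trans (*-congʳ p) (trans (solve 3 (λ c b f → (c :* b) :* f := (c :* f) :* b) refl c b f)
    (trans (*-congʳ r) (solve 3 (λ e d b → (e :* d) :* b := (e :* b) :* d) refl e d b))))

  *-assoc-fraction : ∀ a b c d e f → ((a * c) * e) * (b * (d * f)) ≈ (a * (c * e)) * ((b * d) * f)
  *-assoc-fraction = solve 6 (λ a b c d e f → ((a :* c) :* e) :* (b :* (d :* f)) := (a :* (c :* e)) :* ((b :* d) :* f)) refl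

  *-comm-fraction : ∀ a b c d → (a * c) * (d * b) ≈ (c * a) * (b * d)
  *-comm-fraction = solve 4 (λ a b c d → (a :* c) :* (d :* b) := (c :* a) :* (b :* d)) refl

  -- The element z stands for the numerator of `0K`, the list with the single entry 0, which equals
  -- the empty list only up to trailing zeros.
  +-identityˡ-fraction : ∀ a b {z} → z ≈ 0# → (z * b + a * 1#) * b ≈ a * (1# * b)
  +-identityˡ-fraction a b z≈0 = trans (*-congʳ (trans (+-cong (trans (*-congʳ z≈0) (zeroˡ b)) (*-identityʳ a)) (+-identityˡ a)))
    (*-congˡ (sym (*-identityˡ b)))

  *-identityˡ-fraction : ∀ a b → (1# * a) * b ≈ a * (1# * b)
  *-identityˡ-fraction a b = trans (*-congʳ (*-identityˡ a)) (*-congˡ (sym (*-identityˡ b)))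

-- The field ℚ(q)

import Algebra.Morphism.Construct.Identity as Identity
import Algebra.Morphism.RingMonomorphism as RingMonomorphism
open import Data.Integer as ℤ using (ℤ; +_)
import Data.Integer.Properties as ℤₚ
open import Data.List using (List; []; _∷_; _++_; map; length; reverse; replicate; upTo; applyUpTo)
import Data.List.Properties as Listₚ
open import Data.List.Relation.Binary.Permutation.Propositional.Properties using (All-resp-↭; ↭-reverse)
open import Data.List.Relation.Unary.All using (All; []; _∷_)
import Data.List.Relation.Unary.All.Properties as All

open import Defs

-- Integer polynomials as a subring of the formal power series

module ℤ⟦x⟧ = PowerSeries ℤₚ.+-*-commutativeRing

coeff-+ : ∀ p r i → coeff (p +ₚ r) i ≡ coeff p i ℤ.+ coeff r i
coeff-+ []      r       i       = ≡.sym (ℤₚ.+-identityˡ _)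
coeff-+ (a ∷ p) []      i       = ≡.sym (ℤₚ.+-identityʳ _)
coeff-+ (a ∷ p) (b ∷ r) zero    = ≡.refl
coeff-+ (a ∷ p) (b ∷ r) (suc i) = coeff-+ p r i

coeff-scale : ∀ a p i → coeff (map (a ℤ.*_) p) i ≡ a ℤ.* coeff p i
coeff-scale a []      i       = ≡.sym (ℤₚ.*-zeroʳ a)
coeff-scale a (b ∷ p) zero    = ≡.refl
coeff-scale a (b ∷ p) (suc i) = coeff-scale a p i

coeff-neg : ∀ p i → coeff (negₚ p) i ≡ ℤ.- coeff p i
coeff-neg []      i       = ≡.refl
coeff-neg (a ∷ p) zero    = ≡.refl
coeff-neg (a ∷ p) (suc i) = coeff-neg p i

coeff-* : ∀ p r i → coeff (p *ₚ r) i ≡ (coeff p ℤ⟦x⟧.⊛ coeff r) i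
coeff-* []      r i       = ≡.sym (ℤ⟦x⟧.⊛-zeroˡ (coeff r) i)
coeff-* (a ∷ p) r zero    = ≡.trans (coeff-+ (map (a ℤ.*_) r) (+ 0 ∷ p *ₚ r) 0)
  (≡.trans (ℤₚ.+-identityʳ _) (coeff-scale a r 0))
coeff-* (a ∷ p) r (suc i) = ≡.trans (coeff-+ (map (a ℤ.*_) r) (+ 0 ∷ p *ₚ r) (suc i))
  (≡.cong₂ ℤ._+_ (coeff-scale a r (suc i)) (coeff-* p r i))

-- _≈ₚ_ unfolds to a function type from which the polynomials cannot be inferred; the wrapper keeps them visible.
infix 4 _≐_
record _≐_ (p r : Poly) : Set where
  constructor mk≐
  field at : p ≈ₚ r
open _≐_ public

1ₚ : Poly
1ₚ = + 1 ∷ []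

polyRawRing : RawRing _ _
polyRawRing = record { Carrier = Poly ; _≈_ = _≐_ ; _+_ = _+ₚ_ ; _*_ = _*ₚ_ ; -_ = negₚ ; 0# = 0ₚ ; 1# = 1ₚ }

-- Polynomial equality is equality of coefficient sequences, so all ring laws are pulled back from
-- series and none is proved on lists.
coeff-isRingMonomorphism : RingMorphisms.IsRingMonomorphism polyRawRing (CommutativeRing.rawRing ℤ⟦x⟧.seriesRing) coeff
coeff-isRingMonomorphism = record
  { isRingHomomorphism = record
    { isSemiringHomomorphism = record
      { isNearSemiringHomomorphism = record
        { +-isMonoidHomomorphism = record
          { isMagmaHomomorphism = record
            { isRelHomomorphism = record { cong = at }
            ; homo = coeff-+ }
          ; ε-homo = λ i → ≡.refl }
        ; *-homo = coeff-* }
      ; 1#-homo = λ { zero → ≡.refl ; (suc i) → ≡.refl } }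
    ; -‿homo = coeff-neg }
  ; injective = mk≐ }

polyRing : CommutativeRing _ _
polyRing = record
  { isCommutativeRing = RingMonomorphism.isCommutativeRing coeff-isRingMonomorphism
      (CommutativeRing.isCommutativeRing ℤ⟦x⟧.seriesRing) }

module _ where
  open ℤ⟦x⟧

  -- Leading zeros of g are stripped until its constant term is nonzero, with k bounding the search.
  -- Then the coefficients of f vanish one after another, each from the constant term of a product
  -- with a tail of f.
  ⊛-domain : ∀ k f g → g k ≢ + 0 → f ⊛ g ≋ const (+ 0) → f ≋ const (+ 0)
  ⊛-domain k f g gₖ≢0 fg≡0 with g 0 ℤ.≟ + 0
  ⊛-domain zero    f g gₖ≢0 fg≡0 | yes g₀≡0 = contradiction g₀≡0 gₖ≢0
  ⊛-domain (suc k) f g gₖ≢0 fg≡0 | yes g₀≡0 = ⊛-domain k f (g ∘ suc) gₖ≢0 λ n → begin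
    (f ⊛ g ∘ suc) n                          ≡⟨ ℤₚ.+-identityʳ _ ⟨
    (f ⊛ g ∘ suc) n ℤ.+ + 0                  ≡⟨ ≡.cong (λ a → (f ⊛ g ∘ suc) n ℤ.+ a) (≡.trans (≡.cong (f (suc n) ℤ.*_) g₀≡0) (ℤₚ.*-zeroʳ (f (suc n)))) ⟨
    (f ⊛ g ∘ suc) n ℤ.+ f (suc n) ℤ.* g 0    ≡⟨ ⊛-suc f g n ⟨
    (f ⊛ g) (suc n)                          ≡⟨ fg≡0 (suc n) ⟩
    + 0                                      ∎
    where open ≡.≡-Reasoning
  ... | no g₀≢0 = λ n → go n f fg≡0
    where
    head : ∀ f → f ⊛ g ≋ const (+ 0) → f 0 ≡ + 0
    head f fg≡0 with ℤₚ.i*j≡0⇒i≡0∨j≡0 (f 0) (fg≡0 0)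
    ... | inj₁ f₀≡0 = f₀≡0
    ... | inj₂ g₀≡0 = contradiction g₀≡0 g₀≢0
    go : ∀ n f → f ⊛ g ≋ const (+ 0) → f n ≡ + 0
    go zero    f fg≡0 = head f fg≡0
    go (suc n) f fg≡0 = go n (f ∘ suc) λ i → begin
      (f ∘ suc ⊛ g) i                       ≡⟨ ℤₚ.+-identityˡ _ ⟨
      + 0 ℤ.+ (f ∘ suc ⊛ g) i               ≡⟨ ≡.cong (λ a → a ℤ.* g (suc i) ℤ.+ (f ∘ suc ⊛ g) i) (head f fg≡0) ⟨
      f 0 ℤ.* g (suc i) ℤ.+ (f ∘ suc ⊛ g) i ≡⟨ fg≡0 (suc i) ⟩
      + 0                                   ∎
      where open ≡.≡-Reasoning

-- The negation r ≠ 0 provides no index of a nonzero coefficient. A nonzero coefficient of p, which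
-- is decidable, does: it would force r = 0 with the roles of the factors exchanged.
*ₚ-domain : ∀ p r → ¬ r ≈ₚ 0ₚ → (p *ₚ r) ≐ 0ₚ → p ≐ 0ₚ
*ₚ-domain p r r≉0 pr≈0 = mk≐ λ i → decide i (coeff p i ℤ.≟ + 0)
  where
  decide : ∀ i → Dec (coeff p i ≡ + 0) → coeff p i ≡ + 0
  decide i (yes pᵢ≡0) = pᵢ≡0
  decide i (no pᵢ≢0)  = contradiction
    (⊛-domain i (coeff r) (coeff p) pᵢ≢0 λ n →
      ≡.trans (ℤ⟦x⟧.⊛-comm (coeff r) (coeff p) n) (≡.trans (≡.sym (coeff-* p r n)) (at pr≈0 n)))
    r≉0

module _ where
  open CommutativeRing polyRing
  open RingProperties ring using (-‿distribˡ-*; x∙y⁻¹≈ε⇒x≈y)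

  *ₚ-cancelʳ : ∀ p p′ r → ¬ r ≈ₚ 0ₚ → (p *ₚ r) ≐ (p′ *ₚ r) → p ≐ p′
  *ₚ-cancelʳ p p′ r r≉0 eq = x∙y⁻¹≈ε⇒x≈y p p′ (*ₚ-domain (p - p′) r r≉0
    (trans (distribʳ r p (- p′)) (trans (+-cong eq (sym (-‿distribˡ-* p′ r))) (-‿inverseʳ (p′ *ₚ r)))))

  Valid-* : ∀ p r → ¬ p ≈ₚ 0ₚ → ¬ r ≈ₚ 0ₚ → ¬ (p *ₚ r) ≈ₚ 0ₚ
  Valid-* p r p≉0 r≉0 pr≈0 = p≉0 (at (*ₚ-domain p r r≉0 (mk≐ pr≈0)))

-- Without η, and with operations defined by copatterns, the unifier never unfolds fractions.
record ℚ⟨q⟩ : Set where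
  no-eta-equality
  constructor _,_
  field
    fraction : K
    valid    : Valid fraction
open ℚ⟨q⟩ public

numerator denominator : ℚ⟨q⟩ → Poly
numerator   x = num (fraction x)
denominator x = den (fraction x)

infix 4 _≃_
record _≃_ (x y : ℚ⟨q⟩) : Set where
  constructor mk≃
  field cross : (numerator x *ₚ denominator y) ≐ (numerator y *ₚ denominator x)
open _≃_ public

1ₚ≉0 : ¬ 1ₚ ≈ₚ 0ₚ
1ₚ≉0 eq with eq 0
... | ()

module _ where
  open CommutativeRing polyRing
  open FractionIdentities commutativeSemiring

  infixl 6 _⊞_
  infixl 7 _⊠_

  _⊞_ _⊠_ : ℚ⟨q⟩ → ℚ⟨q⟩ → ℚ⟨q⟩
  fraction (x ⊞ y) = fraction x +K fraction y
  valid    (x ⊞ y) = Valid-* (denominator x) (denominator y) (valid x) (valid y)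
  fraction (x ⊠ y) = fraction x *K fraction y
  valid    (x ⊠ y) = Valid-* (denominator x) (denominator y) (valid x) (valid y)

  ⊟_ : ℚ⟨q⟩ → ℚ⟨q⟩
  fraction (⊟ x) = -K fraction x
  valid    (⊟ x) = valid x

  0ᶠ 1ᶠ : ℚ⟨q⟩
  fraction 0ᶠ = 0K
  valid    0ᶠ = 1ₚ≉0
  fraction 1ᶠ = 1K
  valid    1ᶠ = 1ₚ≉0

  [0]≐0 : (+ 0 ∷ []) ≐ 0ₚ
  [0]≐0 = mk≐ λ { zero → ≡.refl ; (suc i) → ≡.refl }

  -- Here validity is indispensable: the middle denominator can be cancelled because it is nonzero.
  ≃-trans : ∀ {x y z} → x ≃ y → y ≃ z → x ≃ z
  ≃-trans {x} {y} {z} (mk≃ p) (mk≃ r) = mk≃ (*ₚ-cancelʳ _ _ (denominator y) (valid y)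
    (trans-fraction (numerator x) (denominator x) (numerator y) (denominator y) (numerator z) (denominator z) p r))

  ⊞-identityˡ : ∀ x → 0ᶠ ⊞ x ≃ x
  ⊞-identityˡ x = mk≃ (+-identityˡ-fraction (numerator x) (denominator x) [0]≐0)

  ⊞-comm : ∀ x y → x ⊞ y ≃ y ⊞ x
  ⊞-comm x y = mk≃ (+-comm-fraction (numerator x) (denominator x) (numerator y) (denominator y))

  ⊠-comm : ∀ x y → x ⊠ y ≃ y ⊠ x
  ⊠-comm x y = mk≃ (*-comm-fraction (numerator x) (denominator x) (numerator y) (denominator y))

  ⊠-identityˡ : ∀ x → 1ᶠ ⊠ x ≃ x
  ⊠-identityˡ x = mk≃ (*-identityˡ-fraction (numerator x) (denominator x))

  ⊟-inverseˡ : ∀ x → ⊟ x ⊞ x ≃ 0ᶠ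
  ⊟-inverseˡ x = mk≃ (begin
    (- a * b + a * b) * 1ₚ   ≈⟨ *-congʳ (distribʳ b (- a) a) ⟨
    (- a + a) * b * 1ₚ       ≈⟨ *-congʳ (*-congʳ (-‿inverseˡ a)) ⟩
    0# * b * 1ₚ              ≈⟨ *-congʳ {x = 1ₚ} (zeroˡ b) ⟩
    0# * 1ₚ                  ≈⟨ zeroˡ 1ₚ ⟩
    0#                       ≈⟨ zeroˡ (b * b) ⟨
    0# * (b * b)             ≈⟨ *-congʳ {x = b * b} [0]≐0 ⟨
    (+ 0 ∷ []) * (b * b)     ∎)
    where
    open SetoidReasoning setoid
    a = numerator x
    b = denominator x

  ⊠-distribʳ : ∀ x y z → (y ⊞ z) ⊠ x ≃ y ⊠ x ⊞ z ⊠ x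
  ⊠-distribʳ x y z = mk≃ (distribʳ-fraction (numerator x) (denominator x) (numerator y) (denominator y) (numerator z) (denominator z))

  ⊞-cong : ∀ {x y z w} → x ≃ y → z ≃ w → x ⊞ z ≃ y ⊞ w
  ⊞-cong {x} {y} {z} {w} (mk≃ p) (mk≃ r) = mk≃ (+-cong-fraction
    {numerator x} {denominator x} {numerator y} {denominator y} {numerator z} {denominator z} {numerator w} {denominator w} p r)

  ⊠-cong : ∀ {x y z w} → x ≃ y → z ≃ w → x ⊠ z ≃ y ⊠ w
  ⊠-cong {x} {y} {z} {w} (mk≃ p) (mk≃ r) = mk≃ (*-cong-fraction
    {numerator x} {denominator x} {numerator y} {denominator y} {numerator z} {denominator z} {numerator w} {denominator w} p r)

  ⊟-cong : ∀ {x y} → x ≃ y → ⊟ x ≃ ⊟ y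
  ⊟-cong {x} {y} (mk≃ p) = mk≃ (trans (sym (-‿distribˡ-* (numerator x) (denominator y)))
    (trans (-‿cong p) (-‿distribˡ-* (numerator y) (denominator x))))
    where open RingProperties ring using (-‿distribˡ-*)

ℚ⟨q⟩-ring : CommutativeRing _ _
ℚ⟨q⟩-ring = record
  { Carrier = ℚ⟨q⟩ ; _≈_ = _≃_ ; _+_ = _⊞_ ; _*_ = _⊠_ ; -_ = ⊟_ ; 0# = 0ᶠ ; 1# = 1ᶠ
  ; isCommutativeRing = record
    { isRing = record
      { +-isAbelianGroup = record
        { isGroup = record
          { isMonoid = record
            { isSemigroup = record
              { isMagma = record { isEquivalence = ≃-equivalence ; ∙-cong = ⊞-cong }
              ; assoc = λ x y z → mk≃ (+-assoc-fraction (numerator x) (denominator x) (numerator y) (denominator y) (numerator z) (denominator z)) }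
            ; identity = ⊞-identityˡ , λ x → ≃-trans (⊞-comm x 0ᶠ) (⊞-identityˡ x) }
          ; inverse = ⊟-inverseˡ , λ x → ≃-trans (⊞-comm x (⊟ x)) (⊟-inverseˡ x)
          ; ⁻¹-cong = ⊟-cong }
        ; comm = ⊞-comm }
      ; *-cong = ⊠-cong
      ; *-assoc = λ x y z → mk≃ (*-assoc-fraction (numerator x) (denominator x) (numerator y) (denominator y) (numerator z) (denominator z))
      ; *-identity = ⊠-identityˡ , λ x → ≃-trans (⊠-comm x 1ᶠ) (⊠-identityˡ x)
      ; distrib = (λ x y z → ≃-trans (⊠-comm x (y ⊞ z)) (≃-trans (⊠-distribʳ x y z) (⊞-cong (⊠-comm y x) (⊠-comm z x))))
                , ⊠-distribʳ }
    ; *-comm = ⊠-comm } }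
  where
  open CommutativeRing polyRing
  open FractionIdentities commutativeSemiring
  ≃-equivalence : IsEquivalence _≃_
  ≃-equivalence = record { refl = mk≃ refl ; sym = λ p → mk≃ (sym (cross p)) ; trans = ≃-trans }

open import Data.Nat using (_+_; _*_)
open import Data.Nat.Combinatorics using (_C_; nCk+nC[k+1]≡[n+1]C[k+1]; nC1≡n)

-- Evaluation of polynomials and its effect on reversed coefficient lists

module Evaluation {c ℓ} (R : CommutativeRing c ℓ) {ι : ℤ → CommutativeRing.Carrier R}
  (ι-hom : RingMorphisms.IsRingHomomorphism
    (CommutativeRing.rawRing ℤₚ.+-*-commutativeRing) (CommutativeRing.rawRing R) ι) where
  private
    module R = CommutativeRing R
  open CommutativeRing R renaming (_+_ to _⊹_; _*_ to _∙_) hiding (_≈_)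
  open SetoidReasoning setoid
  open NaturalSolver commutativeSemiring using (solve; _:=_; _:+_; _:*_)
  open SemiringExp commutativeSemiring using (_^_; ^-congʳ)
  open RingMorphisms.IsRingHomomorphism ι-hom
  open RingProperties ring using (-‿distribʳ-*; -‿+-comm; -0#≈0#)

  eval : Carrier → Poly → Carrier
  eval t []      = 0#
  eval t (a ∷ p) = ι a ⊹ t ∙ eval t p

  module _ (t : Carrier) where

    eval-0 : ∀ p → p ≈ₚ 0ₚ → eval t p R.≈ 0#
    eval-0 []      p≈0 = refl
    eval-0 (a ∷ p) p≈0 = begin
      ι a ⊹ t ∙ eval t p   ≈⟨ +-cong (reflexive (≡.cong ι (p≈0 0))) (*-congˡ (eval-0 p (p≈0 ∘ suc))) ⟩
      ι (+ 0) ⊹ t ∙ 0#     ≈⟨ +-cong 0#-homo (zeroʳ t) ⟩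
      0# ⊹ 0#              ≈⟨ +-identityˡ 0# ⟩
      0#                   ∎

    eval-cong : ∀ p r → p ≈ₚ r → eval t p R.≈ eval t r
    eval-cong []      r       p≈r = sym (eval-0 r (≡.sym ∘ p≈r))
    eval-cong (a ∷ p) []      p≈r = eval-0 (a ∷ p) p≈r
    eval-cong (a ∷ p) (b ∷ r) p≈r = +-cong (reflexive (≡.cong ι (p≈r 0))) (*-congˡ (eval-cong p r (p≈r ∘ suc)))

    eval-+ : ∀ p r → eval t (p +ₚ r) R.≈ eval t p ⊹ eval t r
    eval-+ []      r       = sym (+-identityˡ _)
    eval-+ (a ∷ p) []      = sym (+-identityʳ _)
    eval-+ (a ∷ p) (b ∷ r) = trans (+-cong (+-homo a b) (*-congˡ (eval-+ p r)))
      (solve 5 (λ a b t x y → a :+ b :+ t :* (x :+ y) := (a :+ t :* x) :+ (b :+ t :* y)) refl _ _ _ _ _)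

    eval-scale : ∀ a p → eval t (map (a ℤ.*_) p) R.≈ ι a ∙ eval t p
    eval-scale a []      = sym (zeroʳ _)
    eval-scale a (b ∷ p) = trans (+-cong (*-homo a b) (*-congˡ (eval-scale a p)))
      (solve 4 (λ a b t x → a :* b :+ t :* (a :* x) := a :* (b :+ t :* x)) refl _ _ _ _)

    eval-* : ∀ p r → eval t (p *ₚ r) R.≈ eval t p ∙ eval t r
    eval-* []      r = sym (zeroˡ _)
    eval-* (a ∷ p) r = begin
      eval t (map (a ℤ.*_) r +ₚ (+ 0 ∷ p *ₚ r))
        ≈⟨ eval-+ (map (a ℤ.*_) r) (+ 0 ∷ p *ₚ r) ⟩
      eval t (map (a ℤ.*_) r) ⊹ (ι (+ 0) ⊹ t ∙ eval t (p *ₚ r))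
        ≈⟨ +-cong (eval-scale a r) (trans (+-cong 0#-homo (*-congˡ (eval-* p r))) (+-identityˡ _)) ⟩
      ι a ∙ eval t r ⊹ t ∙ (eval t p ∙ eval t r)
        ≈⟨ solve 4 (λ a t x y → a :* y :+ t :* (x :* y) := (a :+ t :* x) :* y) refl _ _ _ _ ⟩
      (ι a ⊹ t ∙ eval t p) ∙ eval t r ∎

    eval-neg : ∀ p → eval t (negₚ p) R.≈ - eval t p
    eval-neg []      = sym -0#≈0#
    eval-neg (a ∷ p) = begin
      ι (ℤ.- a) ⊹ t ∙ eval t (negₚ p)   ≈⟨ +-cong (-‿homo a) (trans (*-congˡ (eval-neg p)) (sym (-‿distribʳ-* t _))) ⟩
      - ι a ⊹ - (t ∙ eval t p)          ≈⟨ -‿+-comm (ι a) (t ∙ eval t p) ⟩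
      - (ι a ⊹ t ∙ eval t p)            ∎

    eval-++ : ∀ p r → eval t (p ++ r) R.≈ eval t p ⊹ t ^ length p ∙ eval t r
    eval-++ []      r = sym (trans (+-identityˡ _) (*-identityˡ _))
    eval-++ (a ∷ p) r = trans (+-congˡ (*-congˡ (eval-++ p r)))
      (solve 5 (λ a t x y z → a :+ t :* (x :+ y :* z) := a :+ t :* x :+ t :* y :* z) refl _ _ _ _ _)

    eval-pad : ∀ L p → eval t (pad L p) R.≈ eval t p
    eval-pad L []      = zeros (L ∸ 0)
      where
      zeros : ∀ k → eval t (replicate k (+ 0)) R.≈ 0#
      zeros zero    = refl
      zeros (suc k) = trans (+-cong 0#-homo (trans (*-congˡ (zeros k)) (zeroʳ t))) (+-identityˡ 0#)
    eval-pad zero    (a ∷ p) = reflexive (≡.cong (eval t) (Listₚ.++-identityʳ (a ∷ p)))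
    eval-pad (suc L) (a ∷ p) = +-congˡ (*-congˡ (eval-pad L p))

  -- Reversal amounts to tˡ⁻¹·p(1/t) for a list of length l; the extra factor t on the left avoids
  -- the exponent l - 1, which fails for the empty list.
  eval-reverse : ∀ t s → t ∙ s R.≈ 1# → ∀ p → t ∙ eval t (reverse p) R.≈ t ^ length p ∙ eval s p
  eval-reverse t s ts≈1 []      = trans (zeroʳ t) (sym (zeroʳ _))
  eval-reverse t s ts≈1 (a ∷ p) = begin
    t ∙ eval t (reverse (a ∷ p))
      ≡⟨ ≡.cong (λ r → t ∙ eval t r) (Listₚ.unfold-reverse a p) ⟩
    t ∙ eval t (reverse p ++ a ∷ [])
      ≈⟨ *-congˡ (eval-++ t (reverse p) (a ∷ [])) ⟩
    t ∙ (eval t (reverse p) ⊹ t ^ length (reverse p) ∙ (ι a ⊹ t ∙ 0#))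
      ≈⟨ *-congˡ (+-congˡ (*-cong (^-congʳ t (Listₚ.length-reverse p)) (trans (+-congˡ (zeroʳ t)) (+-identityʳ _)))) ⟩
    t ∙ (eval t (reverse p) ⊹ t ^ length p ∙ ι a)
      ≈⟨ trans (distribˡ _ _ _) (+-congʳ (eval-reverse t s ts≈1 p)) ⟩
    t ^ length p ∙ eval s p ⊹ t ∙ (t ^ length p ∙ ι a)
      ≈⟨ +-congʳ (trans (*-congʳ ts≈1) (*-identityˡ _)) ⟨
    t ∙ s ∙ (t ^ length p ∙ eval s p) ⊹ t ∙ (t ^ length p ∙ ι a)
      ≈⟨ solve 5 (λ t s l x a → t :* s :* (l :* x) :+ t :* (l :* a) := t :* l :* (a :+ s :* x)) refl _ _ _ _ _ ⟩
    t ∙ t ^ length p ∙ (ι a ⊹ s ∙ eval s p) ∎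

length-pad : ∀ L p → length p ≤ L → length (pad L p) ≡ L
length-pad L p p≤L = ≡.trans (Listₚ.length-++ p)
  (≡.trans (≡.cong (length p ℕ.+_) (Listₚ.length-replicate (L ∸ length p))) (ℕₚ.m+[n∸m]≡n p≤L))

≈ₚ0⇒All : ∀ p → p ≈ₚ 0ₚ → All (_≡ + 0) p
≈ₚ0⇒All []      p≈0 = []
≈ₚ0⇒All (a ∷ p) p≈0 = p≈0 0 ∷ ≈ₚ0⇒All p (p≈0 ∘ suc)

All⇒≈ₚ0 : ∀ {p} → All (_≡ + 0) p → p ≈ₚ 0ₚ
All⇒≈ₚ0 []         i       = ≡.refl
All⇒≈ₚ0 (a≡0 ∷ ps) zero    = a≡0
All⇒≈ₚ0 (a≡0 ∷ ps) (suc i) = All⇒≈ₚ0 ps i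

-- A polynomial is zero when all its entries are; this property survives permutation and passes to
-- the prefix p.
reverse-pad-≉0 : ∀ L p → ¬ p ≈ₚ 0ₚ → ¬ reverse (pad L p) ≈ₚ 0ₚ
reverse-pad-≉0 L p p≉0 rev≈0 =
  p≉0 (All⇒≈ₚ0 (All.++⁻ˡ p (All-resp-↭ (↭-reverse (pad L p)) (≈ₚ0⇒All (reverse (pad L p)) rev≈0))))

private
  module ℚq = CommutativeRing ℚ⟨q⟩-ring
  module ℤq = CommutativeRing polyRing

open SemiringExp ℚq.commutativeSemiring using (_^_; ^-congʳ; ^-homo-*)
open SemiringMult ℚq.semiring using () renaming (_×_ to _×ᴿ_)
open Units ℚ⟨q⟩-ring

recip : (x : ℚ⟨q⟩) → ¬ numerator x ≈ₚ 0ₚ → ℚ⟨q⟩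
fraction (recip x x≉0) = denominator x // numerator x
valid    (recip x x≉0) = x≉0

recip-law : ∀ x x≉0 → x ⊠ recip x x≉0 ≃ 1ᶠ
recip-law x x≉0 = mk≃ (ℤq.trans (ℤq.*-identityʳ _) (ℤq.trans (ℤq.*-comm (numerator x) (denominator x)) (ℤq.sym (ℤq.*-identityˡ _))))

unit : ∀ x → ¬ numerator x ≈ₚ 0ₚ → IsUnit x
unit x x≉0 = record { inverse = recip x x≉0 ; law = recip-law x x≉0 }

embed : Poly → ℚ⟨q⟩
fraction (embed p) = p // 1ₚ
valid    (embed p) = 1ₚ≉0

embed-cong : ∀ {p r} → p ≐ r → embed p ≃ embed r
embed-cong {p} {r} p≐r = mk≃ (ℤq.*-congʳ {x = 1ₚ} p≐r)

embed-+ : ∀ p r → embed (p +ₚ r) ≃ embed p ⊞ embed r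
embed-+ p r = mk≃ (begin
  (p +ₚ r) *ₚ (1ₚ *ₚ 1ₚ)                ≈⟨ ℤq.*-congˡ {x = p +ₚ r} (ℤq.*-identityˡ 1ₚ) ⟩
  (p +ₚ r) *ₚ 1ₚ                        ≈⟨ ℤq.*-congʳ {x = 1ₚ} (ℤq.+-cong (ℤq.*-identityʳ p) (ℤq.*-identityʳ r)) ⟨
  ((p *ₚ 1ₚ) +ₚ (r *ₚ 1ₚ)) *ₚ 1ₚ        ∎)
  where open SetoidReasoning ℤq.setoid

embed-* : ∀ p r → embed (p *ₚ r) ≃ embed p ⊠ embed r
embed-* p r = mk≃ (ℤq.*-congˡ {x = p *ₚ r} (ℤq.*-identityˡ 1ₚ))

integer : ℤ → ℚ⟨q⟩
integer a = embed (a ∷ [])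

integer-hom : RingMorphisms.IsRingHomomorphism (CommutativeRing.rawRing ℤₚ.+-*-commutativeRing) ℚq.rawRing integer
integer-hom = record
  { isSemiringHomomorphism = record
    { isNearSemiringHomomorphism = record
      { +-isMonoidHomomorphism = record
        { isMagmaHomomorphism = record
          { isRelHomomorphism = record { cong = λ { ≡.refl → ℚq.refl } }
          ; homo = λ a b → embed-+ (a ∷ []) (b ∷ []) }
        ; ε-homo = mk≃ ℤq.refl }
      ; *-homo = λ a b → ℚq.trans
          (embed-cong (mk≐ λ { zero → ≡.sym (ℤₚ.+-identityʳ _) ; (suc i) → ≡.refl })) (embed-* (a ∷ []) (b ∷ [])) }
    ; 1#-homo = mk≃ ℤq.refl }
  ; -‿homo = λ a → mk≃ ℤq.refl }

integer-× : ∀ n → n ×ᴿ 1ᶠ ≃ integer (+ n)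
integer-× zero    = mk≃ ℤq.refl
integer-× (suc n) = ℚq.trans (ℚq.+-cong (mk≃ {y = integer (+ 1)} ℤq.refl) (integer-× n)) (ℚq.sym (embed-+ (+ 1 ∷ []) (+ n ∷ [])))

inv : ℕ → ℚ⟨q⟩
inv zero    = 1ᶠ
inv (suc n) = recip (integer (+ suc n)) λ eq → contradiction (eq 0) λ ()

inv-law : ∀ n → (suc n ×ᴿ 1ᶠ) ⊠ inv (suc n) ≃ 1ᶠ
inv-law n = ℚq.trans (ℚq.*-congʳ (integer-× (suc n))) (recip-law (integer (+ suc n)) _)

-- The fraction `1K ÷ q` is used literally, so that the series built on it matches `expq (1K ÷ q)`.
q̂ q̂⁻¹ : ℚ⟨q⟩
q̂            = embed (+ 0 ∷ + 1 ∷ [])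
fraction q̂⁻¹ = 1K ÷ q
valid    q̂⁻¹ = λ eq → contradiction (eq 1) λ ()

qq⁻¹≃1 : q̂ ⊠ q̂⁻¹ ≃ 1ᶠ
qq⁻¹≃1 = mk≃ (mk≐ λ { 0 → ≡.refl ; 1 → ≡.refl ; (suc (suc i)) → coeffs i })
  where
  coeffs : ∀ i → coeff (numerator (q̂ ⊠ q̂⁻¹) *ₚ 1ₚ) (suc (suc i)) ≡ coeff (1ₚ *ₚ denominator (q̂ ⊠ q̂⁻¹)) (suc (suc i))
  coeffs zero    = ≡.refl
  coeffs (suc i) = ≡.refl

open Evaluation ℚ⟨q⟩-ring integer-hom

embed-∷ : ∀ a p → embed (a ∷ p) ≃ integer a ⊞ q̂ ⊠ embed p
embed-∷ a p = begin
  embed (a ∷ p)                                      ≈⟨ embed-cong (mk≐ split) ⟩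
  embed ((a ∷ []) +ₚ ((+ 0 ∷ + 1 ∷ []) *ₚ p))        ≈⟨ embed-+ (a ∷ []) ((+ 0 ∷ + 1 ∷ []) *ₚ p) ⟩
  integer a ⊞ embed ((+ 0 ∷ + 1 ∷ []) *ₚ p)          ≈⟨ ℚq.+-congˡ (embed-* (+ 0 ∷ + 1 ∷ []) p) ⟩
  integer a ⊞ q̂ ⊠ embed p                            ∎
  where
  open SetoidReasoning ℚq.setoid
  x*p : ∀ i → coeff ((+ 0 ∷ + 1 ∷ []) *ₚ p) i ≡ coeff (+ 0 ∷ p) i
  x*p i = ≡.trans (coeff-+ (map (+ 0 ℤ.*_) p) (+ 0 ∷ 1ₚ *ₚ p) i)
    (≡.trans (≡.cong₂ ℤ._+_ (coeff-scale (+ 0) p i) (rest i)) (ℤₚ.+-identityˡ _))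
    where
    rest : ∀ i → coeff (+ 0 ∷ 1ₚ *ₚ p) i ≡ coeff (+ 0 ∷ p) i
    rest zero    = ≡.refl
    rest (suc i) = at (ℤq.*-identityˡ p) i
  split : ∀ i → coeff (a ∷ p) i ≡ coeff ((a ∷ []) +ₚ ((+ 0 ∷ + 1 ∷ []) *ₚ p)) i
  split i = ≡.sym (≡.trans (coeff-+ (a ∷ []) ((+ 0 ∷ + 1 ∷ []) *ₚ p) i) (≡.trans (≡.cong (λ b → coeff (a ∷ []) i ℤ.+ b) (x*p i)) (add i)))
    where
    add : ∀ i → coeff (a ∷ []) i ℤ.+ coeff (+ 0 ∷ p) i ≡ coeff (a ∷ p) i
    add zero    = ℤₚ.+-identityʳ a
    add (suc i) = ℤₚ.+-identityˡ _

eval-q : ∀ p → eval q̂ p ≃ embed p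
eval-q []      = mk≃ (ℤq.*-congʳ {x = 1ₚ} [0]≐0)
eval-q (a ∷ p) = ℚq.trans (ℚq.+-congˡ {x = integer a} (ℚq.*-congˡ {x = q̂} (eval-q p))) (ℚq.sym (embed-∷ a p))

at-q⁻¹ : Poly → ℚ⟨q⟩
at-q⁻¹ = eval q̂⁻¹

-- Numerator and denominator are padded to the same length L, so the power of q obtained here is
-- common to both and cancels in their quotient.
reverse-pad-law : ∀ L p → length p ≤ L → q̂ ⊠ embed (reverse (pad L p)) ≃ q̂ ^ L ⊠ at-q⁻¹ p
reverse-pad-law L p p≤L = begin
  q̂ ⊠ embed (reverse (pad L p))              ≈⟨ ℚq.*-congˡ {x = q̂} (eval-q (reverse (pad L p))) ⟨
  q̂ ⊠ eval q̂ (reverse (pad L p))             ≈⟨ eval-reverse q̂ q̂⁻¹ qq⁻¹≃1 (pad L p) ⟩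
  q̂ ^ length (pad L p) ⊠ at-q⁻¹ (pad L p)    ≈⟨ ℚq.*-cong (^-congʳ q̂ (length-pad L p p≤L)) (eval-pad q̂⁻¹ L p) ⟩
  q̂ ^ L ⊠ at-q⁻¹ p                           ∎
  where open SetoidReasoning ℚq.setoid

σ̂ : ℚ⟨q⟩ → ℚ⟨q⟩
fraction (σ̂ x) = σ (fraction x)
valid    (σ̂ x) = reverse-pad-≉0 _ (denominator x) (valid x)

q̂-unit : IsUnit q̂
q̂-unit = record { inverse = q̂⁻¹ ; law = qq⁻¹≃1 }

-- Up to powers of q, p(1/q) is the reversed polynomial, which is nonzero with p.
at-q⁻¹-unit : ∀ p → ¬ p ≈ₚ 0ₚ → IsUnit (at-q⁻¹ p)
at-q⁻¹-unit p p≉0 = unit-factor (ℚq.sym (reverse-pad-law (length p) p ℕₚ.≤-refl))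
  (unit-* q̂-unit (unit (embed (reverse (pad (length p) p))) (reverse-pad-≉0 (length p) p p≉0)))

-- The substitution q ↦ 1/q and the transfer to the definitions

open Quotients ℚ⟨q⟩-ring
open CommutativeSemigroupProperties ℚq.*-commutativeSemigroup using (x∙yz≈y∙xz)
open RingProperties ℚq.ring using (-‿distribˡ-*)
open Sums ℚ⟨q⟩-ring

-- Determines `σ̂ x` as a(1/q)/b(1/q). The homomorphism laws rest on this and on properties of
-- evaluation, no longer on lists.
σ̂-law : ∀ x → σ̂ x ⊠ at-q⁻¹ (denominator x) ≃ at-q⁻¹ (numerator x)
σ̂-law x = unit-cancel (unit-^ q̂-unit L) (begin
  q̂ ^ L ⊠ (σ̂ x ⊠ at-q⁻¹ b)               ≈⟨ x∙yz≈y∙xz (q̂ ^ L) (σ̂ x) (at-q⁻¹ b) ⟩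
  σ̂ x ⊠ (q̂ ^ L ⊠ at-q⁻¹ b)               ≈⟨ ℚq.*-congˡ (reverse-pad-law L b (ℕₚ.m≤n⊔m (length a) (length b))) ⟨
  σ̂ x ⊠ (q̂ ⊠ embed (reverse (pad L b)))  ≈⟨ x∙yz≈y∙xz (σ̂ x) q̂ (embed (reverse (pad L b))) ⟩
  q̂ ⊠ (σ̂ x ⊠ embed (reverse (pad L b)))  ≈⟨ ℚq.*-congˡ (mk≃ (ℤq.*-assoc (reverse (pad L a)) (reverse (pad L b)) 1ₚ)) ⟩
  q̂ ⊠ embed (reverse (pad L a))           ≈⟨ reverse-pad-law L a (ℕₚ.m≤m⊔n (length a) (length b)) ⟩
  q̂ ^ L ⊠ at-q⁻¹ a                        ∎)
  where
  open SetoidReasoning ℚq.setoid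
  a = numerator x
  b = denominator x
  L = length a ℕ.⊔ length b

private
  denominator-unit : ∀ x → IsUnit (at-q⁻¹ (denominator x))
  denominator-unit x = at-q⁻¹-unit (denominator x) (valid x)

  denominators-unit : ∀ x y → IsUnit (at-q⁻¹ (denominator x) ⊠ at-q⁻¹ (denominator y))
  denominators-unit x y = unit-* (denominator-unit x) (denominator-unit y)

-- Equal fractions may be padded to different lengths, so this is invisible on the reversed lists;
-- evaluation at 1/q depends only on the polynomials.
σ̂-cong : ∀ {x y} → x ≃ y → σ̂ x ≃ σ̂ y
σ̂-cong {x} {y} x≃y = unit-cancel (denominators-unit x y) (quotient-cong (σ̂-law x) (σ̂-law y) (begin
  at-q⁻¹ (numerator x) ⊠ at-q⁻¹ (denominator y)   ≈⟨ eval-* q̂⁻¹ (numerator x) (denominator y) ⟨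
  at-q⁻¹ (numerator x *ₚ denominator y)           ≈⟨ eval-cong q̂⁻¹ (numerator x *ₚ denominator y) (numerator y *ₚ denominator x) (at (cross x≃y)) ⟩
  at-q⁻¹ (numerator y *ₚ denominator x)           ≈⟨ eval-* q̂⁻¹ (numerator y) (denominator x) ⟩
  at-q⁻¹ (numerator y) ⊠ at-q⁻¹ (denominator x)   ∎))
  where open SetoidReasoning ℚq.setoid

σ̂-+ : ∀ x y → σ̂ (x ⊞ y) ≃ σ̂ x ⊞ σ̂ y
σ̂-+ x y = unit-cancel (denominators-unit x y) (begin
  at-q⁻¹ b ⊠ at-q⁻¹ d ⊠ σ̂ (x ⊞ y)            ≈⟨ ℚq.*-congʳ (eval-* q̂⁻¹ b d) ⟨
  at-q⁻¹ (b *ₚ d) ⊠ σ̂ (x ⊞ y)                ≈⟨ ℚq.*-comm _ _ ⟩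
  σ̂ (x ⊞ y) ⊠ at-q⁻¹ (b *ₚ d)                ≈⟨ σ̂-law (x ⊞ y) ⟩
  at-q⁻¹ ((a *ₚ d) +ₚ (c *ₚ b))              ≈⟨ eval-+ q̂⁻¹ (a *ₚ d) (c *ₚ b) ⟩
  at-q⁻¹ (a *ₚ d) ⊞ at-q⁻¹ (c *ₚ b)          ≈⟨ ℚq.+-cong (eval-* q̂⁻¹ a d) (eval-* q̂⁻¹ c b) ⟩
  at-q⁻¹ a ⊠ at-q⁻¹ d ⊞ at-q⁻¹ c ⊠ at-q⁻¹ b  ≈⟨ quotient-+ (σ̂-law x) (σ̂-law y) ⟨
  at-q⁻¹ b ⊠ at-q⁻¹ d ⊠ (σ̂ x ⊞ σ̂ y)          ∎)
  where
  open SetoidReasoning ℚq.setoid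
  a = numerator x
  b = denominator x
  c = numerator y
  d = denominator y

σ̂-* : ∀ x y → σ̂ (x ⊠ y) ≃ σ̂ x ⊠ σ̂ y
σ̂-* x y = unit-cancel (denominators-unit x y) (begin
  at-q⁻¹ b ⊠ at-q⁻¹ d ⊠ σ̂ (x ⊠ y)     ≈⟨ ℚq.*-congʳ (eval-* q̂⁻¹ b d) ⟨
  at-q⁻¹ (b *ₚ d) ⊠ σ̂ (x ⊠ y)         ≈⟨ ℚq.*-comm _ _ ⟩
  σ̂ (x ⊠ y) ⊠ at-q⁻¹ (b *ₚ d)         ≈⟨ σ̂-law (x ⊠ y) ⟩
  at-q⁻¹ (a *ₚ c)                     ≈⟨ eval-* q̂⁻¹ a c ⟩
  at-q⁻¹ a ⊠ at-q⁻¹ c                 ≈⟨ quotient-* (σ̂-law x) (σ̂-law y) ⟨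
  at-q⁻¹ b ⊠ at-q⁻¹ d ⊠ (σ̂ x ⊠ σ̂ y)   ∎)
  where
  open SetoidReasoning ℚq.setoid
  a = numerator x
  b = denominator x
  c = numerator y
  d = denominator y

σ̂-neg : ∀ x → σ̂ (⊟ x) ≃ ⊟ σ̂ x
σ̂-neg x = unit-cancel (denominator-unit x) (begin
  at-q⁻¹ b ⊠ σ̂ (⊟ x)        ≈⟨ ℚq.*-comm _ _ ⟩
  σ̂ (⊟ x) ⊠ at-q⁻¹ b        ≈⟨ σ̂-law (⊟ x) ⟩
  at-q⁻¹ (negₚ a)           ≈⟨ eval-neg q̂⁻¹ a ⟩
  ⊟ at-q⁻¹ a                ≈⟨ ℚq.-‿cong (σ̂-law x) ⟨
  ⊟ (σ̂ x ⊠ at-q⁻¹ b)        ≈⟨ -‿distribˡ-* (σ̂ x) (at-q⁻¹ b) ⟩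
  ⊟ σ̂ x ⊠ at-q⁻¹ b          ≈⟨ ℚq.*-comm _ _ ⟩
  at-q⁻¹ b ⊠ ⊟ σ̂ x          ∎)
  where
  open SetoidReasoning ℚq.setoid
  a = numerator x
  b = denominator x

σ̂-hom : RingMorphisms.IsRingHomomorphism ℚq.rawRing ℚq.rawRing σ̂
σ̂-hom = record
  { isSemiringHomomorphism = record
    { isNearSemiringHomomorphism = record
      { +-isMonoidHomomorphism = record
        { isMagmaHomomorphism = record
          { isRelHomomorphism = record { cong = σ̂-cong }
          ; homo = σ̂-+ }
        ; ε-homo = mk≃ ℤq.refl }
      ; *-homo = σ̂-* }
    ; 1#-homo = mk≃ ℤq.refl }
  ; -‿homo = σ̂-neg }

σ̂-q : σ̂ q̂ ≃ q̂⁻¹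
σ̂-q = mk≃ (mk≐ λ { 0 → ≡.refl ; 1 → ≡.refl ; 2 → ≡.refl ; (suc (suc (suc i))) → coeffs i })
  where
  coeffs : ∀ i → coeff (numerator (σ̂ q̂) *ₚ denominator q̂⁻¹) (suc (suc (suc i))) ≡ coeff (numerator q̂⁻¹ *ₚ denominator (σ̂ q̂)) (suc (suc (suc i)))
  coeffs zero    = ≡.refl
  coeffs (suc i) = ≡.refl

open Evaluation ℤₚ.+-*-commutativeRing (Identity.isRingHomomorphism (CommutativeRing.rawRing ℤₚ.+-*-commutativeRing) ≡.refl)
  using () renaming (eval to evalℤ; eval-+ to evalℤ-+; eval-* to evalℤ-*; eval-0 to evalℤ-0)

-- Specialising q to 1, where [n] takes the value n, shows that [n] ≠ 0.
record AtOne (x : ℚ⟨q⟩) (v : ℤ) : Set where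
  field
    numerator-value   : evalℤ (+ 1) (numerator x) ≡ v
    denominator-value : evalℤ (+ 1) (denominator x) ≡ + 1
open AtOne

AtOne-+ : ∀ {x y v w} → AtOne x v → AtOne y w → AtOne (x ⊞ y) (v ℤ.+ w)
AtOne-+ {x} {y} {v} {w} p r = record
  { numerator-value = begin
      evalℤ (+ 1) ((a *ₚ d) +ₚ (c *ₚ b))
        ≡⟨ evalℤ-+ (+ 1) (a *ₚ d) (c *ₚ b) ⟩
      evalℤ (+ 1) (a *ₚ d) ℤ.+ evalℤ (+ 1) (c *ₚ b)
        ≡⟨ ≡.cong₂ ℤ._+_ (evalℤ-* (+ 1) a d) (evalℤ-* (+ 1) c b) ⟩
      evalℤ (+ 1) a ℤ.* evalℤ (+ 1) d ℤ.+ evalℤ (+ 1) c ℤ.* evalℤ (+ 1) b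
        ≡⟨ ≡.cong₂ ℤ._+_ (≡.cong₂ ℤ._*_ (numerator-value p) (denominator-value r))
                         (≡.cong₂ ℤ._*_ (numerator-value r) (denominator-value p)) ⟩
      v ℤ.* + 1 ℤ.+ w ℤ.* + 1
        ≡⟨ ≡.cong₂ ℤ._+_ (ℤₚ.*-identityʳ v) (ℤₚ.*-identityʳ w) ⟩
      v ℤ.+ w ∎
  ; denominator-value = ≡.trans (evalℤ-* (+ 1) b d) (≡.cong₂ ℤ._*_ (denominator-value p) (denominator-value r)) }
  where
  open ≡.≡-Reasoning
  a = numerator x
  b = denominator x
  c = numerator y
  d = denominator y

AtOne-* : ∀ {x y v w} → AtOne x v → AtOne y w → AtOne (x ⊠ y) (v ℤ.* w)
AtOne-* {x} {y} p r = record
  { numerator-value   = ≡.trans (evalℤ-* (+ 1) (numerator x) (numerator y)) (≡.cong₂ ℤ._*_ (numerator-value p) (numerator-value r))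
  ; denominator-value = ≡.trans (evalℤ-* (+ 1) (denominator x) (denominator y)) (≡.cong₂ ℤ._*_ (denominator-value p) (denominator-value r)) }

AtOne-^ : ∀ {x} → AtOne x (+ 1) → ∀ n → AtOne (x ^ n) (+ 1)
AtOne-^ p zero    = record { numerator-value = ≡.refl ; denominator-value = ≡.refl }
AtOne-^ p (suc n) = AtOne-* p (AtOne-^ p n)

AtOne-sum : ∀ n {f} → (∀ i → AtOne (f i) (+ 1)) → AtOne (sum n f) (+ n)
AtOne-sum zero    p = record { numerator-value = ≡.refl ; denominator-value = ≡.refl }
AtOne-sum (suc n) p = AtOne-+ (p 0) (AtOne-sum n (p ∘ suc))

AtOne-q : AtOne q̂ (+ 1)
AtOne-q = record { numerator-value = ≡.refl ; denominator-value = ≡.refl }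

AtOne-q⁻¹ : AtOne q̂⁻¹ (+ 1)
AtOne-q⁻¹ = record { numerator-value = ≡.refl ; denominator-value = ≡.refl }

fraction-^ : ∀ x n → fraction (x ^ n) ≡ fraction x ^K n
fraction-^ x zero    = ≡.refl
fraction-^ x (suc n) = ≡.cong (fraction x *K_) (fraction-^ x n)

-- The equality is propositional: addition and zero of the ring have those of `K` as their fraction
-- components.
sumK-fraction : ∀ n f̂ {f : ℕ → K} → (∀ i → fraction (f̂ i) ≡ f i) → fraction (sum n f̂) ≡ sumK (map f (upTo n))
sumK-fraction n f̂ {f} eq = ≡.trans (go n f̂ eq) (≡.cong sumK (≡.sym (Listₚ.map-upTo f n)))
  where
  go : ∀ n f̂ {f : ℕ → K} → (∀ i → fraction (f̂ i) ≡ f i) → fraction (sum n f̂) ≡ sumK (applyUpTo f n)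
  go zero    f̂ eq = ≡.refl
  go (suc n) f̂ eq = ≡.cong₂ _+K_ (eq 0) (go n (f̂ ∘ suc) (eq ∘ suc))

-- The q-exponential series with parameter q or 1/q

module QSeries (t : ℚ⟨q⟩) (t₁ : AtOne t (+ 1)) where
  open QAnalogs ℚ⟨q⟩-ring t public using ([_])

  []≉0 : ∀ n → ¬ numerator [ suc n ] ≈ₚ 0ₚ
  []≉0 n eq = contradiction
    (≡.trans (≡.sym (numerator-value (AtOne-sum (suc n) (AtOne-^ t₁)))) (evalℤ-0 (+ 1) (numerator [ suc n ]) eq)) λ ()

  []-unit : ∀ n → IsUnit [ suc n ]
  []-unit n = unit [ suc n ] ([]≉0 n)

  factorial : ℕ → ℚ⟨q⟩
  factorial zero    = 1ᶠ
  factorial (suc n) = factorial n ⊠ [ suc n ]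

  factorial≉0 : ∀ n → ¬ numerator (factorial n) ≈ₚ 0ₚ
  factorial≉0 zero    = 1ₚ≉0
  factorial≉0 (suc n) = Valid-* (numerator (factorial n)) (numerator [ suc n ]) (factorial≉0 n) ([]≉0 n)

  ρ : ℕ → ℚ⟨q⟩
  ρ n = recip (factorial n) (factorial≉0 n)

  ρ-zero : ρ 0 ≃ 1ᶠ
  ρ-zero = mk≃ ℤq.refl

  ρ-suc : ∀ n → [ suc n ] ⊠ ρ (suc n) ≃ ρ n
  ρ-suc n = unit-cancel (unit (factorial n) (factorial≉0 n)) (ℚq.trans (ℚq.sym (ℚq.*-assoc _ _ _))
    (ℚq.trans (recip-law (factorial (suc n)) (factorial≉0 (suc n))) (ℚq.sym (recip-law (factorial n) (factorial≉0 n)))))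

  fraction-[] : ∀ n → fraction [ n ] ≡ qint (fraction t) n
  fraction-[] n = sumK-fraction n (t ^_) (fraction-^ t)

  fraction-factorial : ∀ n → fraction (factorial n) ≡ qfact (fraction t) n
  fraction-factorial zero    = ≡.refl
  fraction-factorial (suc n) = ≡.cong₂ _*K_ (fraction-factorial n) (fraction-[] (suc n))

  -- The factor `1ᶠ` mirrors the numerator in `1K ÷ qfact t n` and keeps the underlying fractions
  -- literally equal.
  exp Exp : ℕ → ℚ⟨q⟩
  exp n = 1ᶠ ⊠ ρ n
  Exp n = t ^ (n C 2) ⊠ ρ n

  fraction-exp : ∀ n → fraction (exp n) ≡ expq (fraction t) n
  fraction-exp n = ≡.cong (1K ÷_) (fraction-factorial n)

  fraction-Exp : ∀ n → fraction (Exp n) ≡ Expq (fraction t) n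
  fraction-Exp n = ≡.cong₂ _÷_ (fraction-^ t (n C 2)) (fraction-factorial n)

  exp-zero : exp 0 ≃ 1ᶠ
  exp-zero = ℚq.trans (ℚq.*-identityˡ (ρ 0)) ρ-zero

  exp-suc : ∀ n → [ suc n ] ⊠ exp (suc n) ≃ exp n
  exp-suc n = ℚq.trans (x∙yz≈y∙xz [ suc n ] 1ᶠ (ρ (suc n))) (ℚq.*-congˡ (ρ-suc n))

  Exp-zero : Exp 0 ≃ 1ᶠ
  Exp-zero = ℚq.trans (ℚq.*-identityˡ (ρ 0)) ρ-zero

  Exp-suc : ∀ n → [ suc n ] ⊠ Exp (suc n) ≃ t ^ n ⊠ Exp n
  Exp-suc n = begin
    [ suc n ] ⊠ (t ^ (suc n C 2) ⊠ ρ (suc n))  ≈⟨ x∙yz≈y∙xz [ suc n ] (t ^ (suc n C 2)) (ρ (suc n)) ⟩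
    t ^ (suc n C 2) ⊠ ([ suc n ] ⊠ ρ (suc n))  ≈⟨ ℚq.*-cong (^-congʳ t (C-suc n)) (ρ-suc n) ⟩
    t ^ (n + n C 2) ⊠ ρ n                      ≈⟨ ℚq.*-congʳ (^-homo-* t n (n C 2)) ⟩
    t ^ n ⊠ t ^ (n C 2) ⊠ ρ n                  ≈⟨ ℚq.*-assoc _ _ _ ⟩
    t ^ n ⊠ (t ^ (n C 2) ⊠ ρ n)                ∎
    where
    open SetoidReasoning ℚq.setoid
    C-suc : ∀ n → suc n C 2 ≡ n + n C 2
    C-suc n = ≡.trans (≡.sym (nCk+nC[k+1]≡[n+1]C[k+1] n 1)) (≡.cong (_+ n C 2) (nC1≡n n))

open PowerSeries ℚ⟨q⟩-ring
open Recurrences.WithInverses ℚ⟨q⟩-ring inv inv-law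
open PowerProducts ℚ⟨q⟩-ring using (partialProduct; divisorTerm-∤; divisorTerm-multiple)

≃⇒≈ : ∀ {x y a b} → fraction x ≡ a → fraction y ≡ b → x ≃ y → a ≈ b
≃⇒≈ ≡.refl ≡.refl x≃y = at (cross x≃y)

≈⇒≃ : ∀ {x y a b} → fraction x ≡ a → fraction y ≡ b → a ≈ b → x ≃ y
≈⇒≃ ≡.refl ≡.refl a≈b = mk≃ (mk≐ a≈b)

fraction-one : ∀ n → fraction (one n) ≡ onePS n
fraction-one zero    = ≡.refl
fraction-one (suc n) = ≡.refl

-- The value at 0 is not constrained by IsPowerProduct, so it is replaced by a valid fraction.
validated : (g : ℕ → K) → (∀ n → 1 ≤ n → Valid (g n)) → ℕ → ℚ⟨q⟩
validated g g-valid zero    = 1ᶠ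
validated g g-valid (suc n) = g (suc n) , g-valid (suc n) (s≤s z≤n)

module _ (g : ℕ → K) (g-valid : ∀ n → 1 ≤ n → Valid (g n)) where
  private
    ĝ : ℕ → ℚ⟨q⟩
    ĝ = validated g g-valid

  fraction-divisorTerm : ∀ n d → fraction (divisorTerm ĝ (suc n) d) ≡ divTerm g (suc n) d
  fraction-divisorTerm n zero       = ≡.refl
  fraction-divisorTerm n (suc zero) = ≡.refl
  fraction-divisorTerm n d@(suc (suc k)) with d ∣? suc n
  ... | no d∤n = ≡.trans (≡.cong fraction (divisorTerm-∤ ĝ inv inv-law d∤n))
          (≡.sym (≡.cong (if_then value else 0K) (dec-false (d ∣? suc n) d∤n)))
    where value = (((-K 1K) ^K d) *K (g (suc n ℕ./ d) ^K d)) ÷ fromℕ d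
  ... | yes (divides zero ())
  ... | yes (divides (suc m) ≡.refl) = begin
    fraction (divisorTerm ĝ (suc m * d) d)
      ≡⟨ ≡.cong fraction (divisorTerm-multiple ĝ inv inv-law k (suc m)) ⟩
    (fraction ((⊟ 1ᶠ) ^ d) *K fraction (ĝ (suc m) ^ d)) ÷ fromℕ d
      ≡⟨ ≡.cong₂ (λ x y → (x *K y) ÷ fromℕ d) (fraction-^ (⊟ 1ᶠ) d) (fraction-^ (ĝ (suc m)) d) ⟩
    (((-K 1K) ^K d) *K (g (suc m) ^K d)) ÷ fromℕ d
      ≡⟨ ≡.cong (λ j → (((-K 1K) ^K d) *K (g j ^K d)) ÷ fromℕ d) (m*n/n≡m (suc m) d) ⟨
    value
      ≡⟨ ≡.cong (if_then value else 0K) (dec-true (d ∣? suc m * d) (divides (suc m) ≡.refl)) ⟨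
    divTerm g (suc m * d) d ∎
    where
    open ≡.≡-Reasoning
    value = (((-K 1K) ^K d) *K (g (suc m * d ℕ./ d) ^K d)) ÷ fromℕ d

  fraction-divisorSum : ∀ n → fraction (divisorSum ĝ (suc n)) ≡ divSum g (suc n)
  fraction-divisorSum n = sumK-fraction (suc (suc n)) (divisorTerm ĝ (suc n)) (fraction-divisorTerm n)

  -- Below degree `suc N`, `partialProd` returns the previous value, while the ring version adds a
  -- vanishing term: the fractions differ as pairs. A valid element with exactly the prescribed
  -- fraction, equal to the target only up to `_≃_`, bridges the gap.
  record Represents (a : K) (x : ℚ⟨q⟩) : Set where
    field
      representative : ℚ⟨q⟩
      fraction≡      : fraction representative ≡ a
      ≃-target       : representative ≃ x
  open Represents

  partialProd-represents : ∀ N m → Represents (partialProd g N m) (partialProduct ĝ N m)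
  partialProd-represents zero m = record { representative = one m ; fraction≡ = fraction-one m ; ≃-target = ℚq.refl }
  partialProd-represents (suc N) m with does (suc N ℕ.≤? m) in N<m?
  ... | true  = record
    { representative = representative P ⊞ ĝ (suc N) ⊠ representative P′
    ; fraction≡      = ≡.cong₂ (λ a b → a +K (g (suc N) *K b)) (fraction≡ P) (fraction≡ P′)
    ; ≃-target       = ℚq.+-cong (≃-target P) (ℚq.*-congˡ
        (ℚq.trans (≃-target P′) (ℚq.sym (shift-≤ (suc N) (partialProduct ĝ N) (from-does (suc N ℕ.≤? m) N<m?))))) }
    where
    P = partialProd-represents N m
    P′ = partialProd-represents N (m ∸ suc N)
    from-does : ∀ {A : Set} (a? : Dec A) → does a? ≡ true → A
    from-does (yes a) _ = a
  ... | false = record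
    { representative = representative P
    ; fraction≡      = fraction≡ P
    ; ≃-target       = ℚq.trans (≃-target P) (ℚq.sym (ℚq.trans (ℚq.+-congˡ (ℚq.trans
        (ℚq.*-congˡ (shift-< (suc N) (partialProduct ĝ N) (ℕₚ.≰⇒> (from-does (suc N ℕ.≤? m) N<m?)))) (ℚq.zeroʳ _))) (ℚq.+-identityʳ _))) }
    where
    P = partialProd-represents N m
    from-does : ∀ {A : Set} (a? : Dec A) → does a? ≡ false → ¬ A
    from-does (no ¬a) _ = ¬a

  partialProduct≃ : (f̂ : ℕ → ℚ⟨q⟩) {f : PS} → (∀ n → fraction (f̂ n) ≡ f n) → (∀ N m → m ≤ N → partialProd g N m ≈ f m) →
                    ∀ N m → m ≤ N → partialProduct ĝ N m ≃ f̂ m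
  partialProduct≃ f̂ f̂≡f g-product N m m≤N = ℚq.trans (ℚq.sym (≃-target P)) (≈⇒≃ {y = f̂ m} (fraction≡ P) (f̂≡f m) (g-product N m m≤N))
    where P = partialProd-represents N m

-- Instantiation at q and transfer of the results

private
  module Sq   = QSeries q̂ AtOne-q
  module Sq⁻¹ = QSeries q̂⁻¹ AtOne-q⁻¹

open QExponentials.Expansions ℚ⟨q⟩-ring inv inv-law q̂ q̂⁻¹ qq⁻¹≃1 Sq.[]-unit Sq.exp Sq.Exp Sq⁻¹.exp
  Sq.exp-zero Sq.exp-suc Sq.Exp-zero Sq.Exp-suc Sq⁻¹.exp-zero Sq⁻¹.exp-suc

1-q q-1 : ℚ⟨q⟩
1-q = 1ᶠ ⊞ ⊟ q̂
q-1 = q̂ ⊞ ⊟ 1ᶠ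

x-y+y≃x : ∀ x y → (x ⊞ ⊟ y) ⊞ y ≃ x
x-y+y≃x x y = ℚq.trans (ℚq.+-assoc x (⊟ y) y) (ℚq.trans (ℚq.+-congˡ (ℚq.-‿inverseˡ y)) (ℚq.+-identityʳ x))

n[n]≉0 : ∀ n → ¬ numerator (integer (+ suc n) ⊠ Sq.[ suc n ]) ≈ₚ 0ₚ
n[n]≉0 n = Valid-* (+ suc n ∷ []) (numerator Sq.[ suc n ]) (λ eq → contradiction (eq 0) λ ()) (Sq.[]≉0 n)

-- The reciprocal is taken of the whole product n[n], so that the underlying fraction is literally
-- the quotient in the theorem.
log-term : ℚ⟨q⟩ → ℕ → ℚ⟨q⟩
log-term w zero    = 0ᶠ
log-term w (suc n) = w ^ n ⊠ recip (integer (+ suc n) ⊠ Sq.[ suc n ]) (n[n]≉0 n)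

log-term-quotient : ∀ w → IsQuotient w (log-term w)
log-term-quotient w n = begin
  w ^ n ⊠ r ⊠ ((suc n ×ᴿ 1ᶠ) ⊠ Sq.[ suc n ])    ≈⟨ ℚq.*-congˡ (ℚq.*-congʳ (integer-× (suc n))) ⟩
  w ^ n ⊠ r ⊠ d                                 ≈⟨ ℚq.*-assoc _ _ _ ⟩
  w ^ n ⊠ (r ⊠ d)                               ≈⟨ ℚq.*-congˡ (ℚq.trans (ℚq.*-comm r d) (recip-law d (n[n]≉0 n))) ⟩
  w ^ n ⊠ 1ᶠ                                    ≈⟨ ℚq.*-identityʳ _ ⟩
  w ^ n                                         ∎
  where
  open SetoidReasoning ℚq.setoid
  d = integer (+ suc n) ⊠ Sq.[ suc n ]
  r = recip d (n[n]≉0 n)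

fraction-log-term : ∀ w n → fraction (log-term w (suc n)) ≡ (fraction w ^K n) ÷ (fromℕ (suc n) *K qint q (suc n))
fraction-log-term w n = ≡.cong₂ (λ a b → a ÷ (fromℕ (suc n) *K b)) (fraction-^ w n) (Sq.fraction-[] (suc n))

theorem4p1 : (e E : ℕ → K) → IsPowerProduct (expq q) e → IsPowerProduct (Expq q) E →
    (∀ n → 1 ≤ n → e n ≈ divSum e n +K (((1K -K q) ^K (n ∸ 1)) ÷ (fromℕ n *K qint q n)))
    × (∀ n → 1 ≤ n → E n ≈ divSum E n +K (((q -K 1K) ^K (n ∸ 1)) ÷ (fromℕ n *K qint q n)))
    × (Expq q ≈PS expq (1K ÷ q))
    × ((Expq q ⋆ negx (expq q)) ≈PS onePS)
    × (∀ n → (e (2 * n + 1) ≈ E (2 * n + 1)) × (e (2 * n + 1) ≈ σ (e (2 * n + 1))))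
theorem4p1 e E (e-valid , e-product) (E-valid , E-product) =
    (λ { (suc n) _ → ≃⇒≈ ≡.refl (≡.cong₂ _+K_ (fraction-divisorSum e e-valid n) (fraction-log-term 1-q n)) (ê-rec n) })
  , (λ { (suc n) _ → ≃⇒≈ ≡.refl (≡.cong₂ _+K_ (fraction-divisorSum E E-valid n) (fraction-log-term q-1 n)) (Ê-rec n) })
  , (λ n → ≃⇒≈ (Sq.fraction-Exp n) (Sq⁻¹.fraction-exp n) (F≋h n))
  , (λ n → ≃⇒≈ (sumK-fraction (suc n) (λ k → Sq.Exp k ⊠ ((⊟ 1ᶠ) ^ (n ∸ k) ⊠ Sq.exp (n ∸ k))) λ k → ≡.cong₂ _*K_ (Sq.fraction-Exp k)
               (≡.cong₂ _*K_ (fraction-^ (⊟ 1ᶠ) (n ∸ k)) (Sq.fraction-exp (n ∸ k)))) (fraction-one n)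
       (ℚq.trans (ConvolutionSum.⊛-sum ℚ⟨q⟩-ring Sq.Exp (λ k → (⊟ 1ᶠ) ^ k ⊠ Sq.exp k) n) (F⊛f₋≋one n)))
  -- The statement has the index 2n + 1, the recurrences the successor of 2n; the parity argument
  -- applies to the even number 2n.
  , (λ n → ≡.subst (λ k → (e k ≈ E k) × (e k ≈ σ (e k))) (ℕₚ.+-comm 1 (2 * n))
       ( ≃⇒≈ ≡.refl ≡.refl (odd-e≈E (2 * n) (Div.m∣m*n n))
       , ≃⇒≈ ≡.refl ≡.refl (odd-e≈φe σ̂-hom σ̂-q (2 * n) (Div.m∣m*n n))))
  where
  ê Ê : ℕ → ℚ⟨q⟩
  ê = validated e e-valid
  Ê = validated E E-valid
  1-q+q : 1-q ⊞ q̂ ≃ 1ᶠ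
  1-q+q = x-y+y≃x 1ᶠ q̂
  q-1+1 : q-1 ⊞ 1ᶠ ≃ q̂
  q-1+1 = x-y+y≃x q̂ 1ᶠ
  ê-rec : ∀ n → ê (suc n) ≃ divisorSum ê (suc n) ⊞ log-term 1-q (suc n)
  ê-rec = exp-recurrence ê (log-term 1-q) 1-q 1-q+q (log-term-quotient 1-q) (partialProduct≃ e e-valid Sq.exp Sq.fraction-exp e-product)
  Ê-rec : ∀ n → Ê (suc n) ≃ divisorSum Ê (suc n) ⊞ log-term q-1 (suc n)
  Ê-rec = Exp-recurrence Ê (log-term q-1) q-1 q-1+1 (log-term-quotient q-1) (partialProduct≃ E E-valid Sq.Exp Sq.fraction-Exp E-product)
  open OddCoefficients 1-q q-1 1-q+q q-1+1 (log-term 1-q) (log-term q-1)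
    (log-term-quotient 1-q) (log-term-quotient q-1) ê Ê ê-rec Ê-rec
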